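{- Let $d\ge 2$ be an integer, $p$ a prime with $p\equiv 1\pmod d$, $t=\frac{p-1}{d}$, and $T$ a generator of $\widehat{\mathbb F_p^{\times}}$. Then for every integer $x$ with $p\nmid x$, $$p^{d-2}\,{}_{d-1}F_{d-2}\left(\left.\begin{array}{cccc}T^{t}&T^{2t}&\ldots&T^{(d-1)t}\\ {}&\epsilon&\ldots&\epsilon\end{array}\right|x\right)_p\equiv(-1)^d\,{}_{d-1}F_{d-2}\left(\left.\begin{array}{cccc}\tfrac{1}{d}&\tfrac{2}{d}&\ldots&\tfrac{d-1}{d}\\ {}&1&\ldots&1\end{array}\right|x\right)_{\mathrm{tr}(p)}\pmod p.$$
   Context: Characters are regarded as $\mathbb Z_p$-valued (their values are $(p-1)$-th roots of unity, which lie in $\mathbb Z_p$) and extended by $\chi(0)=0$; $\epsilon$ is the trivial character; the congruence means the difference lies in $p\mathbb Z_p$, with $x$ reduced mod $p$ on the left. For characters $A,B$ of $\mathbb F_p^\times$, $\binom{A}{B}:=\frac{B(-1)}{p}\sum_{y\in\mathbb F_p}A(y)\overline B(1-y)$, and Greene's function is ${}_{n+1}F_n\left(\left.\begin{array}{ccc}A_0&\ldots&A_n\\ &B_1\ldots&B_n\end{array}\right|x\right)_p:=\frac{p}{p-1}\sum_\chi\binom{A_0\chi}{\chi}\prod_{i=1}^n\binom{A_i\chi}{B_i\chi}\chi(x)$, summed over all characters $\chi$. The truncated classical series is ${}_{n+1}F_n\left(\left.\begin{array}{ccc}a_0&\ldots&a_n\\ &b_1\ldots&b_n\end{array}\right|x\right)_{\mathrm{tr}(m)}:=\sum_{k=0}^{m-1}\frac{(a_0)_k\cdots(a_n)_k}{(b_1)_k\cdots(b_n)_k\,k!}x^k$,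 where $(a)_0=1$, $(a)_k=a(a+1)\cdots(a+k-1)$. -}

module Defs where

open import Level using (0ℓ)
open import Algebra.Bundles using (CommutativeRing; AbelianGroup; RawRing)
open import Algebra.Morphism.Structures using (IsMonoidHomomorphism)
import Algebra.Definitions.RawMonoid as RawMonoidDefs
import Algebra.Definitions.RawSemiring as RawSemiringDefs
open import Data.Nat.Base as ℕ using (ℕ; zero; suc)
import Data.Nat.Properties as ℕ
import Data.Nat.Divisibility as ℕ
open import Data.Nat.Primality using (Prime; prime⇒nonZero; prime⇒nonTrivial; euclidsLemma)
open import Data.Nat.Coprimality using (prime⇒coprime; coprime-Bézout)
import Data.Nat.Coprimality as Coprimality
open import Data.Nat.GCD using (module Bézout)
open import Data.Integer.Base as ℤ using (ℤ; +_; -[1+_]; +0; +[1+_]; 0ℤ; 1ℤ; -1ℤ)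
import Data.Integer.Properties as ℤ
import Data.Integer.DivMod as ℤ
open import Data.Integer.Divisibility.Signed using (_∣_; divides; _∣?_; ∣⇒∣ᵤ; ∣ᵤ⇒∣)
open import Data.Integer.Tactic.RingSolver using (solve-∀)
open import Data.Rational.Unnormalised.Base as ℚᵘ using (ℚᵘ; mkℚᵘ; 0ℚᵘ; 1ℚᵘ)
open import Data.Fin.Base as Fin using (Fin; toℕ)
open import Data.Vec.Functional using (Vector; head; tail)
open import Data.Product.Base using (∃-syntax; _,_; proj₁; proj₂)
open import Data.Sum.Base using (_⊎_; inj₁; inj₂)
open import Function.Bundles using (Inverse)
open import Relation.Binary.PropositionalEquality as ≡ using (_≡_; refl; cong; cong₂; subst)
import Relation.Binary.Reasoning.Setoid as SetoidReasoning
open import Relation.Nullary using (¬_; Dec; yes; no; contradiction)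

------------------------------------------------------------------------
-- ℤ/mℤ, as the setoid of integers modulo m

infix 4 _≈_[mod_]

record _≈_[mod_] (a b : ℤ) (m : ℕ) : Set where
  constructor congruent
  field
    divisible : + m ∣ a ℤ.- b

open _≈_[mod_] public

private
  module Mod (m : ℕ) where

    M : ℤ
    M = + m

    reflexive : ∀ {a b} → a ≡ b → a ≈ b [mod m ]
    reflexive {a} refl = congruent (divides 0ℤ (ℤ.+-inverseʳ a))

    sym : ∀ {a b} → a ≈ b [mod m ] → b ≈ a [mod m ]
    sym {a} {b} (congruent (divides q eq)) = congruent (divides (ℤ.- q) (begin
      b ℤ.- a            ≡⟨ flip a b ⟩
      ℤ.- (a ℤ.- b)      ≡⟨ cong ℤ.-_ eq ⟩
      ℤ.- (q ℤ.* M)      ≡⟨ ℤ.neg-distribˡ-* q M ⟩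
      ℤ.- q ℤ.* M        ∎))
      where
      open ≡.≡-Reasoning
      flip : ∀ a b → b ℤ.- a ≡ ℤ.- (a ℤ.- b)
      flip = solve-∀

    trans : ∀ {a b c} → a ≈ b [mod m ] → b ≈ c [mod m ] → a ≈ c [mod m ]
    trans {a} {b} {c} (congruent (divides q eq)) (congruent (divides r eq′)) = congruent (divides (q ℤ.+ r) (begin
      a ℤ.- c                        ≡⟨ split a b c ⟩
      (a ℤ.- b) ℤ.+ (b ℤ.- c)        ≡⟨ cong₂ ℤ._+_ eq eq′ ⟩
      q ℤ.* M ℤ.+ r ℤ.* M            ≡⟨ ℤ.*-distribʳ-+ M q r ⟨
      (q ℤ.+ r) ℤ.* M                ∎))
      where
      open ≡.≡-Reasoning
      split : ∀ a b c → a ℤ.- c ≡ (a ℤ.- b) ℤ.+ (b ℤ.- c)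
      split = solve-∀

    +-cong : ∀ {a b c d} → a ≈ b [mod m ] → c ≈ d [mod m ] →
             a ℤ.+ c ≈ b ℤ.+ d [mod m ]
    +-cong {a} {b} {c} {d} (congruent (divides q eq)) (congruent (divides r eq′)) = congruent (divides (q ℤ.+ r) (begin
      (a ℤ.+ c) ℤ.- (b ℤ.+ d)        ≡⟨ split a b c d ⟩
      (a ℤ.- b) ℤ.+ (c ℤ.- d)        ≡⟨ cong₂ ℤ._+_ eq eq′ ⟩
      q ℤ.* M ℤ.+ r ℤ.* M            ≡⟨ ℤ.*-distribʳ-+ M q r ⟨
      (q ℤ.+ r) ℤ.* M                ∎))
      where
      open ≡.≡-Reasoning
      split : ∀ a b c d → (a ℤ.+ c) ℤ.- (b ℤ.+ d) ≡ (a ℤ.- b) ℤ.+ (c ℤ.- d)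
      split = solve-∀

    *-cong : ∀ {a b c d} → a ≈ b [mod m ] → c ≈ d [mod m ] →
             a ℤ.* c ≈ b ℤ.* d [mod m ]
    *-cong {a} {b} {c} {d} (congruent (divides q eq)) (congruent (divides r eq′)) =
      congruent (divides (a ℤ.* r ℤ.+ q ℤ.* d) (begin
      a ℤ.* c ℤ.- b ℤ.* d                        ≡⟨ split a b c d ⟩
      a ℤ.* (c ℤ.- d) ℤ.+ (a ℤ.- b) ℤ.* d        ≡⟨ cong₂ (λ u v → a ℤ.* u ℤ.+ v ℤ.* d) eq′ eq ⟩
      a ℤ.* (r ℤ.* M) ℤ.+ (q ℤ.* M) ℤ.* d        ≡⟨ join a r q d M ⟩
      (a ℤ.* r ℤ.+ q ℤ.* d) ℤ.* M                ∎))
      where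
      open ≡.≡-Reasoning
      split : ∀ a b c d → a ℤ.* c ℤ.- b ℤ.* d ≡ a ℤ.* (c ℤ.- d) ℤ.+ (a ℤ.- b) ℤ.* d
      split = solve-∀
      join : ∀ a r q d M → a ℤ.* (r ℤ.* M) ℤ.+ (q ℤ.* M) ℤ.* d ≡ (a ℤ.* r ℤ.+ q ℤ.* d) ℤ.* M
      join = solve-∀

    -‿cong : ∀ {a b} → a ≈ b [mod m ] → ℤ.- a ≈ ℤ.- b [mod m ]
    -‿cong {a} {b} (congruent (divides q eq)) = congruent (divides (ℤ.- q) (begin
      ℤ.- a ℤ.- ℤ.- b    ≡⟨ flip a b ⟩
      ℤ.- (a ℤ.- b)      ≡⟨ cong ℤ.-_ eq ⟩
      ℤ.- (q ℤ.* M)      ≡⟨ ℤ.neg-distribˡ-* q M ⟩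
      ℤ.- q ℤ.* M        ∎))
      where
      open ≡.≡-Reasoning
      flip : ∀ a b → ℤ.- a ℤ.- ℤ.- b ≡ ℤ.- (a ℤ.- b)
      flip = solve-∀

ℤ/_ : ℕ → CommutativeRing 0ℓ 0ℓ
ℤ/ m = record
  { Carrier = ℤ
  ; _≈_ = _≈_[mod m ]
  ; _+_ = ℤ._+_
  ; _*_ = ℤ._*_
  ; -_ = ℤ.-_
  ; 0# = 0ℤ
  ; 1# = 1ℤ
  ; isCommutativeRing = record
    { isRing = record
      { +-isAbelianGroup = record
        { isGroup = record
          { isMonoid = record
            { isSemigroup = record
              { isMagma = record
                { isEquivalence = record
                  { refl = reflexive refl
                  ; sym = sym
                  ; trans = trans
                  }
                ; ∙-cong = +-cong
                }
              ; assoc = λ a b c → reflexive (ℤ.+-assoc a b c)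
              }
            ; identity = (λ a → reflexive (ℤ.+-identityˡ a)) , (λ a → reflexive (ℤ.+-identityʳ a))
            }
          ; inverse = (λ a → reflexive (ℤ.+-inverseˡ a)) , (λ a → reflexive (ℤ.+-inverseʳ a))
          ; ⁻¹-cong = -‿cong
          }
        ; comm = λ a b → reflexive (ℤ.+-comm a b)
        }
      ; *-cong = *-cong
      ; *-assoc = λ a b c → reflexive (ℤ.*-assoc a b c)
      ; *-identity = (λ a → reflexive (ℤ.*-identityˡ a)) , (λ a → reflexive (ℤ.*-identityʳ a))
      ; distrib = (λ a b c → reflexive (ℤ.*-distribˡ-+ a b c))
                , (λ a b c → reflexive (ℤ.*-distribʳ-+ a b c))
      }
    ; *-comm = λ a b → reflexive (ℤ.*-comm a b)
    }
  }
  where open Mod m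

------------------------------------------------------------------------
-- The p-adic integers, as the inverse limit of the rings ℤ/pⁿ

-- Without η, and with the operations given by copatterns, so that the
-- unifier never compares coherence proofs.
record PadicInt (p : ℕ) : Set where
  no-eta-equality
  field
    approx   : ℕ → ℤ
    coherent : ∀ n → approx (suc n) ≈ approx n [mod p ℕ.^ n ]

open PadicInt public

infix 4 _≈ₚ_

record _≈ₚ_ {p : ℕ} (a b : PadicInt p) : Set where
  constructor levelwise
  field
    level : ∀ n → approx a n ≈ approx b n [mod p ℕ.^ n ]

open _≈ₚ_ public

module _ (p : ℕ) where

  private
    module R (n : ℕ) = CommutativeRing (ℤ/ (p ℕ.^ n))

    infixl 6 _+ₚ_
    infixl 7 _*ₚ_

    _+ₚ_ _*ₚ_ : PadicInt p → PadicInt p → PadicInt p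
    approx   (a +ₚ b) n = approx a n ℤ.+ approx b n
    coherent (a +ₚ b) n = R.+-cong n (coherent a n) (coherent b n)
    approx   (a *ₚ b) n = approx a n ℤ.* approx b n
    coherent (a *ₚ b) n = R.*-cong n (coherent a n) (coherent b n)

    -ₚ_ : PadicInt p → PadicInt p
    approx   (-ₚ a) n = ℤ.- approx a n
    coherent (-ₚ a) n = R.-‿cong n (coherent a n)

  fromℤ : ℤ → PadicInt p
  approx   (fromℤ a) n = a
  coherent (fromℤ a) n = R.refl n

  ℤₚ : CommutativeRing 0ℓ 0ℓ
  ℤₚ = record
    { Carrier = PadicInt p
    ; _≈_ = _≈ₚ_
    ; _+_ = _+ₚ_
    ; _*_ = _*ₚ_
    ; -_ = -ₚ_
    ; 0# = fromℤ 0ℤ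
    ; 1# = fromℤ 1ℤ
    ; isCommutativeRing = record
      { isRing = record
        { +-isAbelianGroup = record
          { isGroup = record
            { isMonoid = record
              { isSemigroup = record
                { isMagma = record
                  { isEquivalence = record
                    { refl = levelwise λ n → R.refl n
                    ; sym = λ eq → levelwise λ n → R.sym n (level eq n)
                    ; trans = λ eq eq′ → levelwise λ n → R.trans n (level eq n) (level eq′ n)
                    }
                  ; ∙-cong = λ eq eq′ → levelwise λ n → R.+-cong n (level eq n) (level eq′ n)
                  }
                ; assoc = λ a b c → levelwise λ n → R.+-assoc n (approx a n) (approx b n) (approx c n)
                }
              ; identity = (λ a → levelwise λ n → R.+-identityˡ n (approx a n))
                         , (λ a → levelwise λ n → R.+-identityʳ n (approx a n))
              }
            ; inverse = (λ a → levelwise λ n → R.-‿inverseˡ n (approx a n))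
                      , (λ a → levelwise λ n → R.-‿inverseʳ n (approx a n))
            ; ⁻¹-cong = λ eq → levelwise λ n → R.-‿cong n (level eq n)
            }
          ; comm = λ a b → levelwise λ n → R.+-comm n (approx a n) (approx b n)
          }
        ; *-cong = λ eq eq′ → levelwise λ n → R.*-cong n (level eq n) (level eq′ n)
        ; *-assoc = λ a b c → levelwise λ n → R.*-assoc n (approx a n) (approx b n) (approx c n)
        ; *-identity = (λ a → levelwise λ n → R.*-identityˡ n (approx a n))
                     , (λ a → levelwise λ n → R.*-identityʳ n (approx a n))
        ; distrib = (λ a b c → levelwise λ n → R.distribˡ n (approx a n) (approx b n) (approx c n))
                  , (λ a b c → levelwise λ n → R.distribʳ n (approx a n) (approx b n) (approx c n))
        }
      ; *-comm = λ a b → levelwise λ n → R.*-comm n (approx a n) (approx b n)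
      }
    }

  private
    module ℤₚ = CommutativeRing ℤₚ

  -- ℚₚ = ℤₚ ⊗ ℚ: fractions of a p-adic integer by a positive integer.
  -- As for ℚᵘ, fractions are not reduced, and equality is by
  -- cross-multiplication (ℤₚ has no torsion).
  record PadicRat : Set where
    constructor _/1+_
    field
      num   : PadicInt p
      den-1 : ℕ

    den : PadicInt p
    den = fromℤ (+ suc den-1)

  open PadicRat

  ℚₚ : RawRing 0ℓ 0ℓ
  ℚₚ = record
    { Carrier = PadicRat
    ; _≈_ = λ u v → num u ℤₚ.* den v ℤₚ.≈ num v ℤₚ.* den u
    ; _+_ = λ u v → (num u ℤₚ.* den v ℤₚ.+ num v ℤₚ.* den u) /1+ den*-1 u v
    ; _*_ = λ u v → (num u ℤₚ.* num v) /1+ den*-1 u v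
    ; -_ = λ u → (ℤₚ.- num u) /1+ den-1 u
    ; 0# = ℤₚ.0# /1+ 0
    ; 1# = ℤₚ.1# /1+ 0
    }
    where
    den*-1 : PadicRat → PadicRat → ℕ
    den*-1 u v = ℕ.pred (suc (den-1 u) ℕ.* suc (den-1 v))

  fromℤₚ : PadicInt p → PadicRat
  fromℤₚ a = a /1+ 0

  fromℚᵘ : ℚᵘ → PadicRat
  fromℚᵘ (mkℚᵘ n d-1) = fromℤ n /1+ d-1

  private
    module ℚₚ = RawRing ℚₚ

  infix 4 _≡ₚ_

  -- Congruence modulo p in ℚₚ: the difference lies in pℤₚ.
  _≡ₚ_ : PadicRat → PadicRat → Set
  u ≡ₚ v = ∃[ z ] (u ℚₚ.+ ℚₚ.- v) ℚₚ.≈ fromℤₚ (fromℤ (+ p) ℤₚ.* z)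

------------------------------------------------------------------------
-- Characters of 𝔽ₚˣ with values in ℤₚ

module Characters (p : ℕ) (p-prime : Prime p) where

  𝔽ₚ : CommutativeRing 0ℓ 0ℓ
  𝔽ₚ = ℤ/ p

  private
    module 𝔽 = CommutativeRing 𝔽ₚ
    module Z = CommutativeRing (ℤₚ p)

    instance
      p≢0 : ℕ.NonZero p
      p≢0 = prime⇒nonZero p-prime

      p-1≢0 : ℕ.NonZero (p ℕ.∸ 1)
      p-1≢0 = ℕ.>-nonZero (ℕ.m<n⇒0<n∸m (ℕ.nonTrivial⇒n>1 p {{prime⇒nonTrivial p-prime}}))

  ∣⇒≈0 : ∀ {a} → + p ∣ a → a 𝔽.≈ 0ℤ
  ∣⇒≈0 {a} p∣a = congruent (subst (+ p ∣_) (≡.sym (ℤ.+-identityʳ a)) p∣a)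

  ≈0⇒∣ : ∀ {a} → a 𝔽.≈ 0ℤ → + p ∣ a
  ≈0⇒∣ {a} (congruent p∣a-0) = subst (+ p ∣_) (ℤ.+-identityʳ a) p∣a-0

  ∣-resp : ∀ {a b} → a 𝔽.≈ b → + p ∣ a → + p ∣ b
  ∣-resp a≈b p∣a = ≈0⇒∣ (𝔽.trans (𝔽.sym a≈b) (∣⇒≈0 p∣a))

  ∣-*ˡ : ∀ {a} b → + p ∣ a → + p ∣ a ℤ.* b
  ∣-*ˡ {a} b (divides q refl) = divides (q ℤ.* b) (swap q b (+ p))
    where
    swap : ∀ q b m → q ℤ.* m ℤ.* b ≡ q ℤ.* b ℤ.* m
    swap = solve-∀

  ∣-*ʳ : ∀ a {b} → + p ∣ b → + p ∣ a ℤ.* b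
  ∣-*ʳ a {b} p∣b = subst (+ p ∣_) (ℤ.*-comm b a) (∣-*ˡ a p∣b)

  euclid : ∀ a b → + p ∣ a ℤ.* b → + p ∣ a ⊎ + p ∣ b
  euclid a b p∣ab with euclidsLemma ℤ.∣ a ∣ ℤ.∣ b ∣ p-prime
                         (subst (p ℕ.∣_) (ℤ.abs-* a b) (∣⇒∣ᵤ p∣ab))
  ... | inj₁ p∣a = inj₁ (∣ᵤ⇒∣ p∣a)
  ... | inj₂ p∣b = inj₂ (∣ᵤ⇒∣ p∣b)

  p∤1 : ¬ + p ∣ 1ℤ
  p∤1 p∣1 = ℕ.nonTrivial⇒≢1 {{prime⇒nonTrivial p-prime}} (ℕ.∣1⇒≡1 (∣⇒∣ᵤ p∣1))

  -- A homomorphism 𝔽ₚˣ → ℤₚˣ extended by 0 ↦ 0: the values at nonzero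
  -- residues are automatically units, since f x * f x⁻¹ = f 1 = 1.
  record Character : Set where
    field
      ⟦_⟧ : ℤ → PadicInt p
      isMonoidHomomorphism : IsMonoidHomomorphism 𝔽.*-rawMonoid Z.*-rawMonoid ⟦_⟧
      0-homo : ⟦ 0ℤ ⟧ Z.≈ Z.0#

    open IsMonoidHomomorphism isMonoidHomomorphism public

  open Character public using (⟦_⟧)

  mkCharacter : (f : ℤ → PadicInt p) →
                (∀ {a b} → a 𝔽.≈ b → f a Z.≈ f b) →
                (∀ a b → f (a ℤ.* b) Z.≈ f a Z.* f b) →
                f 1ℤ Z.≈ Z.1# →
                f 0ℤ Z.≈ Z.0# →
                Character
  mkCharacter f f-cong f-* f-1 f-0 = record
    { ⟦_⟧ = f
    ; isMonoidHomomorphism = record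
      { isMagmaHomomorphism = record
        { isRelHomomorphism = record { cong = f-cong }
        ; homo = f-*
        }
      ; ε-homo = f-1
      }
    ; 0-homo = f-0
    }

  ext-ε : ∀ {a} → Dec (+ p ∣ a) → PadicInt p
  ext-ε (yes _) = Z.0#
  ext-ε (no _)  = Z.1#

  ext-ε-cong : ∀ {a b} → a 𝔽.≈ b → (a? : Dec (+ p ∣ a)) (b? : Dec (+ p ∣ b)) →
               ext-ε a? Z.≈ ext-ε b?
  ext-ε-cong a≈b (yes _) (yes _) = Z.refl
  ext-ε-cong a≈b (no _)  (no _)  = Z.refl
  ext-ε-cong a≈b (yes p∣a) (no p∤b) = contradiction (∣-resp a≈b p∣a) p∤b
  ext-ε-cong a≈b (no p∤a) (yes p∣b) = contradiction (∣-resp (𝔽.sym a≈b) p∣b) p∤a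

  ext-ε-* : ∀ a b (ab? : Dec (+ p ∣ a ℤ.* b)) (a? : Dec (+ p ∣ a)) (b? : Dec (+ p ∣ b)) →
            ext-ε ab? Z.≈ ext-ε a? Z.* ext-ε b?
  ext-ε-* a b (yes _) (yes _) b? = Z.sym (Z.zeroˡ (ext-ε b?))
  ext-ε-* a b (yes _) (no _) (yes _) = Z.sym (Z.zeroʳ Z.1#)
  ext-ε-* a b (yes p∣ab) (no p∤a) (no p∤b) with euclid a b p∣ab
  ... | inj₁ p∣a = contradiction p∣a p∤a
  ... | inj₂ p∣b = contradiction p∣b p∤b
  ext-ε-* a b (no p∤ab) (yes p∣a) _ = contradiction (∣-*ˡ b p∣a) p∤ab
  ext-ε-* a b (no p∤ab) (no _) (yes p∣b) = contradiction (∣-*ʳ a p∣b) p∤ab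
  ext-ε-* a b (no _) (no _) (no _) = Z.sym (Z.*-identityˡ Z.1#)

  ext-ε-1 : (1? : Dec (+ p ∣ 1ℤ)) → ext-ε 1? Z.≈ Z.1#
  ext-ε-1 (yes p∣1) = contradiction p∣1 p∤1
  ext-ε-1 (no _) = Z.refl

  ext-ε-0 : (0? : Dec (+ p ∣ 0ℤ)) → ext-ε 0? Z.≈ Z.0#
  ext-ε-0 (yes _) = Z.refl
  ext-ε-0 (no p∤0) = contradiction (divides 0ℤ refl) p∤0

  ε : Character
  ε = mkCharacter (λ a → ext-ε (+ p ∣? a))
    (λ {a} {b} a≈b → ext-ε-cong a≈b (+ p ∣? a) (+ p ∣? b))
    (λ a b → ext-ε-* a b (+ p ∣? a ℤ.* b) (+ p ∣? a) (+ p ∣? b))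
    (ext-ε-1 (+ p ∣? 1ℤ))
    (ext-ε-0 (+ p ∣? 0ℤ))

  infixl 7 _·_

  _·_ : Character → Character → Character
  A · B = mkCharacter (λ a → ⟦ A ⟧ a Z.* ⟦ B ⟧ a)
    (λ a≈b → Z.*-cong (A.⟦⟧-cong a≈b) (B.⟦⟧-cong a≈b))
    (λ a b → begin
      ⟦ A ⟧ (a ℤ.* b) Z.* ⟦ B ⟧ (a ℤ.* b)
        ≈⟨ Z.*-cong (A.homo a b) (B.homo a b) ⟩
      (⟦ A ⟧ a Z.* ⟦ A ⟧ b) Z.* (⟦ B ⟧ a Z.* ⟦ B ⟧ b)
        ≈⟨ medial (⟦ A ⟧ a) (⟦ A ⟧ b) (⟦ B ⟧ a) (⟦ B ⟧ b) ⟩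
      (⟦ A ⟧ a Z.* ⟦ B ⟧ a) Z.* (⟦ A ⟧ b Z.* ⟦ B ⟧ b) ∎)
    (Z.trans (Z.*-cong A.ε-homo B.ε-homo) (Z.*-identityˡ Z.1#))
    (Z.trans (Z.*-cong A.0-homo B.0-homo) (Z.zeroˡ Z.0#))
    where
    module A = Character A
    module B = Character B
    open SetoidReasoning Z.setoid
    open import Algebra.Properties.CommutativeSemigroup Z.*-commutativeSemigroup
      using () renaming (interchange to medial)

  Inverse-of : ℤ → Set
  Inverse-of a = ∃[ b ] a ℤ.* b 𝔽.≈ 1ℤ

  inverse-resp : ∀ {a r} → a 𝔽.≈ r → Inverse-of r → Inverse-of a
  inverse-resp a≈r (b , rb≈1) =
    b , 𝔽.trans (𝔽.*-cong a≈r 𝔽.refl) rb≈1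

  bézout⇒inverse : ∀ {r} → Bézout.Identity 1 r p → Inverse-of (+ r)
  bézout⇒inverse {r} (Bézout.+- x y eq) = + x , congruent (divides (+ y) (begin
    + r ℤ.* + x ℤ.- 1ℤ               ≡⟨ cong (ℤ._- 1ℤ) (ℤ.*-comm (+ r) (+ x)) ⟩
    + x ℤ.* + r ℤ.- 1ℤ               ≡⟨ cong (ℤ._- 1ℤ) (ℤ.pos-* x r) ⟨
    + (x ℕ.* r) ℤ.- 1ℤ               ≡⟨ cong (λ u → + u ℤ.- 1ℤ) eq ⟨
    + (1 ℕ.+ y ℕ.* p) ℤ.- 1ℤ         ≡⟨⟩
    + (y ℕ.* p)                      ≡⟨ ℤ.pos-* y p ⟩
    + y ℤ.* + p                      ∎))
    where open ≡.≡-Reasoning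
  bézout⇒inverse {r} (Bézout.-+ x y eq) = ℤ.- + x , congruent (divides (ℤ.- + y) (begin
    + r ℤ.* (ℤ.- + x) ℤ.- 1ℤ         ≡⟨ rearrange (+ r) (+ x) ⟩
    ℤ.- (1ℤ ℤ.+ + x ℤ.* + r)         ≡⟨ cong (λ u → ℤ.- (1ℤ ℤ.+ u)) (ℤ.pos-* x r) ⟨
    ℤ.- + (1 ℕ.+ x ℕ.* r)            ≡⟨ cong (λ u → ℤ.- + u) eq ⟩
    ℤ.- + (y ℕ.* p)                  ≡⟨ cong ℤ.-_ (ℤ.pos-* y p) ⟩
    ℤ.- (+ y ℤ.* + p)                ≡⟨ ℤ.neg-distribˡ-* (+ y) (+ p) ⟩
    ℤ.- + y ℤ.* + p                  ∎))
    where
    open ≡.≡-Reasoning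
    rearrange : ∀ r x → r ℤ.* (ℤ.- x) ℤ.- 1ℤ ≡ ℤ.- (1ℤ ℤ.+ x ℤ.* r)
    rearrange = solve-∀

  inverse : ∀ a → ¬ + p ∣ a → Inverse-of a
  inverse a p∤a = inverse-resp a≈r
    (bézout⇒inverse (coprime-Bézout (Coprimality.sym
      (prime⇒coprime p-prime {{ℕ.≢-nonZero r≢0}} (ℤ.n%ℕd<d a p)))))
    where
    r : ℕ
    r = a ℤ.%ℕ p
    a≡ : a ≡ + r ℤ.+ (a ℤ./ℕ p) ℤ.* + p
    a≡ = ℤ.a≡a%ℕn+[a/ℕn]*n a p
    cancel : ∀ r q → r ℤ.+ q ℤ.- r ≡ q
    cancel = solve-∀
    a≈r : a 𝔽.≈ + r
    a≈r = congruent (divides (a ℤ./ℕ p)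
      (≡.trans (cong (ℤ._- + r) a≡) (cancel (+ r) ((a ℤ./ℕ p) ℤ.* + p))))
    r≢0 : ¬ r ≡ 0
    r≢0 r≡0 = p∤a (≈0⇒∣ (subst (λ u → a 𝔽.≈ + u) r≡0 a≈r))

  inverse-unique : ∀ a b c → a ℤ.* b 𝔽.≈ 1ℤ → a ℤ.* c 𝔽.≈ 1ℤ → b 𝔽.≈ c
  inverse-unique a b c ab≈1 ac≈1 = begin
    b                      ≡⟨ ℤ.*-identityʳ b ⟨
    b ℤ.* 1ℤ               ≈⟨ 𝔽.*-cong (𝔽.refl {b}) ac≈1 ⟨
    b ℤ.* (a ℤ.* c)        ≡⟨ rearrange a b c ⟩
    a ℤ.* b ℤ.* c          ≈⟨ 𝔽.*-cong ab≈1 𝔽.refl ⟩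
    1ℤ ℤ.* c               ≡⟨ ℤ.*-identityˡ c ⟩
    c                      ∎
    where
    open SetoidReasoning 𝔽.setoid
    rearrange : ∀ a b c → b ℤ.* (a ℤ.* c) ≡ a ℤ.* b ℤ.* c
    rearrange = solve-∀

  inv′ : ∀ {a} → Dec (+ p ∣ a) → ℤ
  inv′ (yes _)      = 0ℤ
  inv′ {a} (no p∤a) = proj₁ (inverse a p∤a)

  inv′-cong : ∀ {a b} → a 𝔽.≈ b → (a? : Dec (+ p ∣ a)) (b? : Dec (+ p ∣ b)) → inv′ a? 𝔽.≈ inv′ b?
  inv′-cong a≈b (yes _) (yes _) = 𝔽.refl
  inv′-cong a≈b (yes p∣a) (no p∤b) = contradiction (∣-resp a≈b p∣a) p∤b
  inv′-cong a≈b (no p∤a) (yes p∣b) = contradiction (∣-resp (𝔽.sym a≈b) p∣b) p∤a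
  inv′-cong {a} {b} a≈b (no p∤a) (no p∤b) =
    inverse-unique a _ _ (proj₂ (inverse a p∤a)) (proj₂ (inverse-resp a≈b (inverse b p∤b)))

  inv′-* : ∀ a b (ab? : Dec (+ p ∣ a ℤ.* b)) (a? : Dec (+ p ∣ a)) (b? : Dec (+ p ∣ b)) →
           inv′ ab? 𝔽.≈ inv′ a? ℤ.* inv′ b?
  inv′-* a b (yes _) (yes _) b? = 𝔽.refl
  inv′-* a b (yes _) (no p∤a) (yes _) =
    𝔽.sym (𝔽.zeroʳ (proj₁ (inverse a p∤a)))
  inv′-* a b (yes p∣ab) (no p∤a) (no p∤b) with euclid a b p∣ab
  ... | inj₁ p∣a = contradiction p∣a p∤a
  ... | inj₂ p∣b = contradiction p∣b p∤b
  inv′-* a b (no p∤ab) (yes p∣a) _ = contradiction (∣-*ˡ b p∣a) p∤ab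
  inv′-* a b (no p∤ab) (no _) (yes p∣b) = contradiction (∣-*ʳ a p∣b) p∤ab
  inv′-* a b (no p∤ab) (no p∤a) (no p∤b) =
    inverse-unique (a ℤ.* b) _ _ (proj₂ (inverse (a ℤ.* b) p∤ab))
      (product-inverse (inverse a p∤a) (inverse b p∤b))
    where
    open SetoidReasoning 𝔽.setoid
    rearrange : ∀ a b c d → a ℤ.* b ℤ.* (c ℤ.* d) ≡ a ℤ.* c ℤ.* (b ℤ.* d)
    rearrange = solve-∀
    product-inverse : (a⁻¹ : Inverse-of a) (b⁻¹ : Inverse-of b) →
                      a ℤ.* b ℤ.* (proj₁ a⁻¹ ℤ.* proj₁ b⁻¹) 𝔽.≈ 1ℤ
    product-inverse (a′ , aa′≈1) (b′ , bb′≈1) = begin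
      a ℤ.* b ℤ.* (a′ ℤ.* b′)        ≡⟨ rearrange a b a′ b′ ⟩
      a ℤ.* a′ ℤ.* (b ℤ.* b′)        ≈⟨ 𝔽.*-cong aa′≈1 bb′≈1 ⟩
      1ℤ                             ∎

  inv′-1 : (1? : Dec (+ p ∣ 1ℤ)) → inv′ 1? 𝔽.≈ 1ℤ
  inv′-1 (yes p∣1) = contradiction p∣1 p∤1
  inv′-1 (no p∤1) = inverse-unique 1ℤ _ 1ℤ (proj₂ (inverse 1ℤ p∤1)) 𝔽.refl

  inv′-0 : (0? : Dec (+ p ∣ 0ℤ)) → inv′ 0? 𝔽.≈ 0ℤ
  inv′-0 (yes _) = 𝔽.refl
  inv′-0 (no p∤0) = contradiction (divides 0ℤ refl) p∤0

  -- The inverse in 𝔽ₚ, with 0 ↦ 0.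
  inv : ℤ → ℤ
  inv a = inv′ (+ p ∣? a)

  -- The inverse (conjugate) character A̅, A̅(a) = A(a⁻¹).
  infix 9 _⁻

  _⁻ : Character → Character
  A ⁻ = mkCharacter (λ a → ⟦ A ⟧ (inv a))
    (λ {a} {b} a≈b → A.⟦⟧-cong (inv′-cong a≈b (+ p ∣? a) (+ p ∣? b)))
    (λ a b → Z.trans (A.⟦⟧-cong (inv′-* a b (+ p ∣? a ℤ.* b) (+ p ∣? a) (+ p ∣? b)))
      (A.homo (inv a) (inv b)))
    (Z.trans (A.⟦⟧-cong (inv′-1 (+ p ∣? 1ℤ))) A.ε-homo)
    (Z.trans (A.⟦⟧-cong (inv′-0 (+ p ∣? 0ℤ))) A.0-homo)
    where module A = Character A

  at-multiple : ∀ A {a} → + p ∣ a → ⟦ A ⟧ a Z.≈ Z.0#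
  at-multiple A {a} p∣a = Z.trans (Character.⟦⟧-cong A (∣⇒≈0 p∣a)) (Character.0-homo A)

  ext-ε-identity : ∀ A a (a? : Dec (+ p ∣ a)) → ext-ε a? Z.* ⟦ A ⟧ a Z.≈ ⟦ A ⟧ a
  ext-ε-identity A a (yes p∣a) = Z.trans (Z.zeroˡ (⟦ A ⟧ a)) (Z.sym (at-multiple A p∣a))
  ext-ε-identity A a (no _) = Z.*-identityˡ (⟦ A ⟧ a)

  ext-ε-inverse : ∀ A a (a? : Dec (+ p ∣ a)) → ⟦ A ⟧ a Z.* ⟦ A ⟧ (inv′ a?) Z.≈ ext-ε a?
  ext-ε-inverse A a (yes p∣a) =
    Z.trans (Z.*-cong Z.refl (Character.0-homo A))
      (Z.zeroʳ (⟦ A ⟧ a))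
  ext-ε-inverse A a (no p∤a) = begin
    ⟦ A ⟧ a Z.* ⟦ A ⟧ b        ≈⟨ A.homo a b ⟨
    ⟦ A ⟧ (a ℤ.* b)            ≈⟨ A.⟦⟧-cong (proj₂ (inverse a p∤a)) ⟩
    ⟦ A ⟧ 1ℤ                   ≈⟨ A.ε-homo ⟩
    Z.1#                       ∎
    where
    b : ℤ
    b = proj₁ (inverse a p∤a)
    module A = Character A
    open SetoidReasoning Z.setoid

  characters : AbelianGroup 0ℓ 0ℓ
  characters = record
    { Carrier = Character
    ; _≈_ = λ A B → ∀ a → ⟦ A ⟧ a Z.≈ ⟦ B ⟧ a
    ; _∙_ = _·_
    ; ε = ε
    ; _⁻¹ = _⁻
    ; isAbelianGroup = record
      { isGroup = record
        { isMonoid = record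
          { isSemigroup = record
            { isMagma = record
              { isEquivalence = record
                { refl = λ a → Z.refl
                ; sym = λ eq a → Z.sym (eq a)
                ; trans = λ eq eq′ a → Z.trans (eq a) (eq′ a)
                }
              ; ∙-cong = λ eq eq′ a → Z.*-cong (eq a) (eq′ a)
              }
            ; assoc = λ A B C a → Z.*-assoc (⟦ A ⟧ a) (⟦ B ⟧ a) (⟦ C ⟧ a)
            }
          ; identity = identityˡ , λ A a →
              Z.trans (Z.*-comm (⟦ A ⟧ a) (⟦ ε ⟧ a)) (identityˡ A a)
          }
        ; inverse = (λ A a →
              Z.trans (Z.*-comm (⟦ A ⁻ ⟧ a) (⟦ A ⟧ a)) (inverseʳ A a))
          , inverseʳ
        ; ⁻¹-cong = λ eq a → eq (inv a)
        }
      ; comm = λ A B a → Z.*-comm (⟦ A ⟧ a) (⟦ B ⟧ a)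
      }
    }
    where
    identityˡ : ∀ A a → ⟦ ε ⟧ a Z.* ⟦ A ⟧ a Z.≈ ⟦ A ⟧ a
    identityˡ A a = ext-ε-identity A a (+ p ∣? a)
    inverseʳ : ∀ A a → ⟦ A ⟧ a Z.* ⟦ A ⁻ ⟧ a Z.≈ ⟦ ε ⟧ a
    inverseʳ A a = ext-ε-inverse A a (+ p ∣? a)

  private
    module Ĝ = AbelianGroup characters

  infixr 8 _^_ _^ᶻ_

  _^_ : Character → ℕ → Character
  A ^ n = RawMonoidDefs._×_ Ĝ.rawMonoid n A

  _^ᶻ_ : Character → ℤ → Character
  A ^ᶻ (+ n)    = A ^ n
  A ^ᶻ -[1+ n ] = (A ⁻) ^ suc n

  IsGenerator : Character → Set
  IsGenerator T = ∀ χ → ∃[ n ] χ Ĝ.≈ T ^ᶻ n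

  -- A listing of all characters without repetition, over which sums "over
  -- all χ" are taken; such sums do not depend on the listing.
  Listing : ℕ → Set
  Listing N = Inverse (≡.setoid (Fin N)) Ĝ.setoid

  ----------------------------------------------------------------------
  -- Greene's hypergeometric functions

  private
    module Q = RawRing (ℚₚ p)
    open RawSemiringDefs Q.rawSemiring using (sum; product)

  value : Character → ℤ → PadicRat p
  value A a = fromℤₚ p (⟦ A ⟧ a)

  binom : Character → Character → PadicRat p
  binom A B =
    value B -1ℤ Q.* fromℚᵘ p (1ℤ ℚᵘ./ p) Q.*
    sum {p} (λ i → let y = + toℕ i in value A y Q.* value (B ⁻) (1ℤ ℤ.- y))

  module _ {N : ℕ} (listing : Listing N) where

    -- ₙ₊₁Fₙ(A₀, …, Aₙ; B₁, …, Bₙ | x)ₚ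
    greene : ∀ {n} → Vector Character (suc n) → Vector Character n → ℤ → PadicRat p
    greene A B x =
      fromℚᵘ p (+ p ℚᵘ./ (p ℕ.∸ 1)) Q.*
      sum {N} (λ j → let χ = Inverse.to listing j in
        binom (head A · χ) χ Q.*
        product (λ i → binom (tail A i · χ) (B i · χ)) Q.*
        value χ x)

------------------------------------------------------------------------
-- Truncated classical hypergeometric series

open RawSemiringDefs ℚᵘ.+-*-rawSemiring using (sum; product) renaming (_^_ to _^ℚ_)

poch : ℚᵘ → ℕ → ℚᵘ
poch a zero    = 1ℚᵘ
poch a (suc k) = poch a k ℚᵘ.* (a ℚᵘ.+ (+ k ℚᵘ./ 1))

-- Total inverse, 0 ↦ 0. In the series below it is only meaningful when no
-- (bᵢ)ₖ vanishes in the range of summation.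
recip : ℚᵘ → ℚᵘ
recip (mkℚᵘ +0 _)           = 0ℚᵘ
recip q@(mkℚᵘ +[1+ _ ] _)   = ℚᵘ.1/ q
recip q@(mkℚᵘ -[1+ _ ] _)   = ℚᵘ.1/ q

-- ₙ₊₁Fₙ(a₀, …, aₙ; b₁, …, bₙ | x)_tr(m)
truncated : ∀ {n} → Vector ℚᵘ (suc n) → Vector ℚᵘ n → ℤ → ℕ → ℚᵘ
truncated a b x m = sum {m} λ i → let k = toℕ i in
  product (λ j → poch (a j) k) ℚᵘ.*
  recip (product (λ j → poch (b j) k) ℚᵘ.* (+ (k ℕ.!) ℚᵘ./ 1)) ℚᵘ.*
  ((x ℚᵘ./ 1) ^ℚ k)

{-# OPTIONS --safe #-}
-- Modulo p, every ℤₚ-valued character is a power map: the Teichmüller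
-- character ω has exact order p − 1 because the power sums Σ yᵏ vanish for
-- 0 < k < p − 1, so a generator T is ω^g with g prime to p − 1, and the
-- characters are exactly ω^k, 0 ≤ k < p − 1. With A = ω^a, 0 < a < p − 1, and
-- χ = ω^k the Jacobi sum p·binom(Aχ, χ) reduces to
-- (−1)^k Σ y^(a+k) (1−y)^(p−1−k) ≡ −(a+1)ₖ / k!, which follows from the
-- recurrence of the beta integral. As i runs through 1, …, d−1, the character
-- T^(it) runs through ω^(p−1−jt), 1 ≤ j < d, for which a + 1 = p − jt ≡ j/d.
-- The powers of p cancel, leaving the factor 1/(p−1) ≡ −1, so the left side is
-- (−1)^d times the truncated series, whose last term k = p − 1 vanishes modulo
-- p because (1/d)ₚ₋₁ does.

module Submission where

open import Defs
open import Algebra.Bundles using (AbelianGroup; CommutativeRing; RawRing)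
open import Algebra.Definitions.RawSemiring using () renaming (_^_ to pow)
import Algebra.Definitions.RawSemiring as RawSemiringDefs
import Algebra.Properties.CommutativeMonoid.Sum as MonoidSum
import Algebra.Properties.Group as GroupProperties
import Algebra.Properties.Monoid.Mult as MonoidMult
import Algebra.Properties.Semiring.Sum as SemiringSum
open import Data.Nat.Base as ℕ using (ℕ; zero; suc; 2+; _∸_; _≤_; _/_; NonZero)
open import Data.Nat.Base using () renaming (_*_ to _*ℕ_; _^_ to _^ℕ_)
import Data.Nat.Properties as ℕ
import Data.Nat.Divisibility as ℕ
import Data.Nat.DivMod as ℕ
open import Data.Nat.Coprimality using (Coprime; coprime-Bézout)
open import Data.Nat.GCD using (module Bézout)
open import Data.Nat.Primality using (Prime; ¬prime[0]; ¬prime[1])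
import Data.Nat.Tactic.RingSolver as ℕSolver
open import Data.Integer.Base as ℤ using (ℤ; +_; +0; +[1+_]; -[1+_]; 0ℤ; 1ℤ; -1ℤ; _+_; _*_; _-_; -_) renaming (_^_ to _^ℤ_)
import Data.Integer.Properties as ℤ
import Data.Integer.DivMod as ℤ
open import Data.Integer.Divisibility.Signed using (_∣_; divides; _∣?_; ∣⇒∣ᵤ; ∣ᵤ⇒∣; ∣-refl; ∣-trans; *-cancelʳ-∣)
open import Data.Integer.Tactic.RingSolver using (solve-∀)
open import Data.Rational.Unnormalised.Base as ℚᵘ using (ℚᵘ; mkℚᵘ; 1ℚᵘ; ↥_; ↧_) renaming (_/_ to _/ℚ_)
open import Data.Fin.Base as Fin using (Fin; toℕ; fromℕ<)
import Data.Fin.Properties as Fin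
open import Data.Fin.Permutation as Perm using (Permutation; _⟨$⟩ʳ_)
open import Data.Vec.Functional using (Vector; head; tail)
open import Data.Product.Base using (∃-syntax; _×_; _,_; proj₁; proj₂)
open import Data.Sum.Base using (_⊎_; inj₁; inj₂; [_,_]′)
open import Function.Bundles using (Inverse)
open import Relation.Binary.PropositionalEquality as ≡ using (_≡_; refl; cong; cong₂; subst; subst₂)
import Relation.Binary.Reasoning.Setoid as SetoidReasoning
open import Relation.Nullary using (¬_; Dec; yes; no; contradiction)

open RawSemiringDefs ℤ.+-*-rawSemiring using (sum; product)

-- A power of `ω` agrees with the corresponding monomial modulo p, with one exception: `ω ↑ 0` is
-- `ε`, which vanishes at 0, whereas 0^0 = 1. Jacobi sums run over all y, including 0 and 1, so
-- every exponent in them has to be positive. This is why the conjugate of ω^k is written ω^(p-1-k)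
-- with 0 ≤ k < p-1, giving ω^(p-1) and not ω^0 at k = 0, and why exponents appear as `suc a`. An
-- arbitrary generator brings in an unknown exponent g. It is a unit modulo p-1, hence modulo d, so
-- i ↦ -gi permutes 1, ..., d-1, and the residues of the summands are symmetric in the upper
-- parameters. Division by d is avoided: dt = p-1 ≡ -1, so the integer -jt represents j/d. Each
-- binomial carries a p in its denominator, so single factors of Greene's function do not lie in ℤₚ.
-- `Reduces n` therefore records the residue of a fraction together with the power of p still owed.

module ℚΣ = RawSemiringDefs ℚᵘ.+-*-rawSemiring

module ℤ/ (m : ℕ) = CommutativeRing (ℤ/ m)

-- Congruences

^-cong : ∀ {m a b} n → a ≈ b [mod m ] → a ^ℤ n ≈ b ^ℤ n [mod m ]
^-cong {m} zero    a≈b = ℤ/.refl m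
^-cong {m} (suc n) a≈b = ℤ/.*-cong m a≈b (^-cong n a≈b)

coarsen : ∀ {m n a b} → m ℕ.∣ n → a ≈ b [mod n ] → a ≈ b [mod m ]
coarsen m∣n (congruent n∣a-b) = congruent (∣-trans (∣ᵤ⇒∣ m∣n) n∣a-b)

small-congruent⇒≡ : ∀ {n a b} → a ℕ.< n → b ℕ.< n → + a ≈ + b [mod n ] → a ≡ b
small-congruent⇒≡ {n} {a} {b} a<n b<n a≈b = cases (ℕ.≤-total a b)
  where
  ordered : ∀ {a b} → a ℕ.< n → b ℕ.≤ a → + a ≈ + b [mod n ] → a ≡ b
  ordered {a} {b} a<n b≤a (congruent n∣a-b) with a ℕ.∸ b in eq
  ... | zero  = ℕ.≤-antisym (ℕ.m∸n≡0⇒m≤n eq) b≤a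
  ... | suc k = contradiction
    (subst (n ℕ.∣_) (≡.trans (cong ℤ.∣_∣ (≡.trans (ℤ.m-n≡m⊖n a b) (ℤ.⊖-≥ b≤a))) eq) (∣⇒∣ᵤ n∣a-b))
    (ℕ.>⇒∤ (subst (ℕ._< n) eq (ℕ.≤-<-trans (ℕ.m∸n≤m a b) a<n)))
  cases : a ℕ.≤ b ⊎ b ℕ.≤ a → a ≡ b
  cases (inj₁ a≤b) = ≡.sym (ordered b<n a≤b (ℤ/.sym n a≈b))
  cases (inj₂ b≤a) = ordered a<n b≤a a≈b

module _ {n : ℕ} where

  private
    module R = ℤ/ (suc n)

  residue : ℤ → Fin (suc n)
  residue a = fromℕ< (ℤ.n%ℕd<d a (suc n))

  residue-≈ : ∀ a → + toℕ (residue a) R.≈ a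
  residue-≈ a = R.sym (congruent (divides (a ℤ./ℕ suc n) (begin
    a - + toℕ (residue a)
      ≡⟨ cong₂ (λ u v → u - + v) (ℤ.a≡a%ℕn+[a/ℕn]*n a (suc n)) (Fin.toℕ-fromℕ< (ℤ.n%ℕd<d a (suc n))) ⟩
    + (a ℤ.%ℕ suc n) + (a ℤ./ℕ suc n) * + suc n - + (a ℤ.%ℕ suc n)
      ≡⟨ cancel (+ (a ℤ.%ℕ suc n)) ((a ℤ./ℕ suc n) * + suc n) ⟩
    (a ℤ./ℕ suc n) * + suc n ∎)))
    where
    open ≡.≡-Reasoning
    cancel : ∀ r q → r + q - r ≡ q
    cancel = solve-∀

  toℕ-≈-injective : ∀ {i j : Fin (suc n)} → + toℕ i R.≈ + toℕ j → i ≡ j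
  toℕ-≈-injective {i} {j} i≈j = Fin.toℕ-injective (small-congruent⇒≡ (Fin.toℕ<n i) (Fin.toℕ<n j) i≈j)

  -- On all residues, multiplication by `v` undoes multiplication by `u`; 0 is fixed and then
  -- removed, so index `i` stands for the residue i + 1. It serves modulo p for Fermat's little
  -- theorem and modulo d, which need not be prime, for reordering the parameters i/d.
  multiplication-permutes : ∀ u v → u * v R.≈ 1ℤ →
    ∃[ π ] ∀ (i : Fin n) → + suc (toℕ (π ⟨$⟩ʳ i)) R.≈ u * + suc (toℕ i)
  multiplication-permutes u v uv≈1 = Perm.remove Fin.zero π , property
    where
    open SetoidReasoning R.setoid

    cancels : ∀ u v → u * v R.≈ 1ℤ → ∀ i → residue (u * + toℕ (residue (v * + toℕ i))) ≡ i
    cancels u v uv≈1 i = toℕ-≈-injective (begin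
      + toℕ (residue (u * + toℕ (residue (v * + toℕ i))))   ≈⟨ residue-≈ _ ⟩
      u * + toℕ (residue (v * + toℕ i))                     ≈⟨ R.*-cong (R.refl {u}) (residue-≈ _) ⟩
      u * (v * + toℕ i)                                     ≡⟨ ℤ.*-assoc u v _ ⟨
      u * v * + toℕ i                                       ≈⟨ R.*-cong uv≈1 R.refl ⟩
      1ℤ * + toℕ i                                          ≡⟨ ℤ.*-identityˡ _ ⟩
      + toℕ i                                               ∎)

    π : Permutation (suc n) (suc n)
    π = Perm.permutation (λ i → residue (u * + toℕ i)) (λ i → residue (v * + toℕ i))
      (cancels u v uv≈1) (cancels v u (R.trans (R.*-comm v u) uv≈1))

    π-fixes-0 : π ⟨$⟩ʳ Fin.zero ≡ Fin.zero
    π-fixes-0 = toℕ-≈-injective (R.trans (residue-≈ _) (R.zeroʳ u))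

    property : ∀ (i : Fin n) → + suc (toℕ (Perm.remove Fin.zero π ⟨$⟩ʳ i)) R.≈ u * + suc (toℕ i)
    property i = subst (λ j → + toℕ j R.≈ u * + suc (toℕ i))
      (≡.trans (Perm.punchIn-permute π Fin.zero i)
        (cong (λ z → Fin.punchIn z (Perm.remove Fin.zero π ⟨$⟩ʳ i)) π-fixes-0))
      (residue-≈ (u * + suc (toℕ i)))

-- Finite sums and rising factorials

sum-linear : ∀ {n} c (f g : Fin n → ℤ) → sum (λ i → f i + c * g i) ≡ sum f + c * sum g
sum-linear {zero}  c f g = ≡.sym (≡.trans (ℤ.+-identityˡ (c * 0ℤ)) (ℤ.*-zeroʳ c))
sum-linear {suc n} c f g = ≡.trans
  (cong (λ u → f Fin.zero + c * g Fin.zero + u) (sum-linear c (λ i → f (Fin.suc i)) (λ i → g (Fin.suc i))))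
  (rearrange (f Fin.zero) (g Fin.zero) c _ _)
  where
  rearrange : ∀ f₀ g₀ c s t → f₀ + c * g₀ + (s + c * t) ≡ f₀ + s + c * (g₀ + t)
  rearrange = solve-∀

sum-telescope : ∀ n (F : ℕ → ℤ) → sum {n} (λ i → F (suc (toℕ i)) - F (toℕ i)) ≡ F n - F 0
sum-telescope zero    F = ≡.sym (ℤ.+-inverseʳ (F 0))
sum-telescope (suc n) F = ≡.trans
  (cong (λ u → F 1 - F 0 + u) (sum-telescope n (λ i → F (suc i))))
  (rearrange (F 0) (F 1) (F (suc n)))
  where
  rearrange : ∀ a b c → b - a + (c - b) ≡ c - a
  rearrange = solve-∀

product-scale : ∀ {n} c (f : Fin n → ℤ) → product (λ i → c * f i) ≡ c ^ℤ n * product f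
product-scale {zero}  c f = refl
product-scale {suc n} c f = ≡.trans
  (cong (c * f Fin.zero *_) (product-scale c (λ i → f (Fin.suc i))))
  (rearrange c (f Fin.zero) (c ^ℤ n) (product (λ i → f (Fin.suc i))))
  where
  rearrange : ∀ c a r s → c * a * (r * s) ≡ c * r * (a * s)
  rearrange = solve-∀

rising : ℤ → ℕ → ℤ
rising a zero    = 1ℤ
rising a (suc k) = rising a k * (a + + k)

rising-head : ∀ a k → rising a (suc k) ≡ a * rising (1ℤ + a) k
rising-head a zero    = base a
  where
  base : ∀ a → 1ℤ * (a + 0ℤ) ≡ a * 1ℤ
  base = solve-∀
rising-head a (suc k) = ≡.trans
  (cong (_* (a + + suc k)) (rising-head a k)) (step a (rising (1ℤ + a) k) (+ k))
  where
  step : ∀ a r k → a * r * (a + (1ℤ + k)) ≡ a * (r * (1ℤ + a + k))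
  step = solve-∀

-- The discrete power rule: (c+1)_k (c+1+k) and c (c+1)_k differ by (k+1) (c+1)_k, so a rising
-- factorial is a difference up to the factor k + 1.
rising-difference : ∀ c k → + suc k * rising (1ℤ + c) k ≡ rising (1ℤ + c) (suc k) - rising c (suc k)
rising-difference c k = ≡.trans (rearrange c (rising (1ℤ + c) k) (+ k))
  (cong (λ u → rising (1ℤ + c) (suc k) - u) (≡.sym (rising-head c k)))
  where
  rearrange : ∀ c r k → (1ℤ + k) * r ≡ r * (1ℤ + c + k) - c * r
  rearrange = solve-∀

rising-cong : ∀ {m a b} k → a ≈ b [mod m ] → rising a k ≈ rising b k [mod m ]
rising-cong {m} zero    a≈b = ℤ/.refl m
rising-cong {m} (suc k) a≈b = ℤ/.*-cong m (rising-cong k a≈b) (ℤ/.+-cong m a≈b (ℤ/.refl m))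

-- Sums over 𝔽ₚ

-- The analogue over 𝔽ₚ of Euler's beta integral, with monomials in place of characters. Since 0^0 =
-- 1 here, it is matched with Jacobi sums only for positive exponents.
beta : ℕ → ℕ → ℕ → ℤ
beta p n m = sum {p} λ i → (+ toℕ i) ^ℤ n * (1ℤ - + toℕ i) ^ℤ m

beta-recurrence : ∀ p n m → beta p n (suc m) ≡ beta p n m + -1ℤ * beta p (suc n) m
beta-recurrence p n m = ≡.trans
  (MonoidSum.sum-cong-≗ ℤ.+-0-commutativeMonoid {p} (λ i →
    pointwise (+ toℕ i) ((+ toℕ i) ^ℤ n) ((1ℤ - + toℕ i) ^ℤ m)))
  (sum-linear {p} -1ℤ _ _)
  where
  pointwise : ∀ y u v → u * ((1ℤ - y) * v) ≡ u * v + -1ℤ * (y * u * v)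
  pointwise = solve-∀

-- The prime p is written 2+ q from here on, and e = p − 1.
module FiniteField (q : ℕ) (p-prime : Prime (2+ q)) where

  e : ℕ
  e = suc q

  open Characters (2+ q) p-prime using (euclid; ≈0⇒∣; ∣⇒≈0; inverse; p∤1)

  module 𝔽 = ℤ/ (2+ q)
  module Σ𝔽 = MonoidSum 𝔽.+-commutativeMonoid
  module Π𝔽 = MonoidSum 𝔽.*-commutativeMonoid

  p≈0 : + (2+ q) 𝔽.≈ 0ℤ
  p≈0 = ∣⇒≈0 (∣-refl)

  small∤ : ∀ {n} .{{_ : ℕ.NonZero n}} → n ℕ.< (2+ q) → ¬ + (2+ q) ∣ + n
  small∤ n<p p∣n = ℕ.>⇒∤ n<p (∣⇒∣ᵤ p∣n)

  *-cancel-0 : ∀ {a b} → ¬ + (2+ q) ∣ a → a * b 𝔽.≈ 0ℤ → b 𝔽.≈ 0ℤ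
  *-cancel-0 {a} {b} p∤a ab≈0 with euclid a b (≈0⇒∣ ab≈0)
  ... | inj₁ p∣a = contradiction p∣a p∤a
  ... | inj₂ p∣b = ∣⇒≈0 p∣b

  *-cancelˡ : ∀ {a b c} → ¬ + (2+ q) ∣ a → a * b 𝔽.≈ a * c → b 𝔽.≈ c
  *-cancelˡ {a} {b} {c} p∤a (congruent p∣ab-ac) with euclid a (b - c) (subst (+ (2+ q) ∣_) (factor a b c) p∣ab-ac)
    where
    factor : ∀ a b c → a * b - a * c ≡ a * (b - c)
    factor = solve-∀
  ... | inj₁ p∣a = contradiction p∣a p∤a
  ... | inj₂ p∣b-c = congruent p∣b-c

  product∤ : ∀ {n} (f : Fin n → ℤ) → (∀ i → ¬ + (2+ q) ∣ f i) → ¬ + (2+ q) ∣ product f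
  product∤ {zero}  f p∤f p∣1 = p∤1 p∣1
  product∤ {suc n} f p∤f p∣Π with euclid (f Fin.zero) _ p∣Π
  ... | inj₁ p∣f₀ = p∤f Fin.zero p∣f₀
  ... | inj₂ p∣Π′ = product∤ (λ i → f (Fin.suc i)) (λ i → p∤f (Fin.suc i)) p∣Π′

  -- Multiplication by a permutes the nonzero residues.
  fermat : ∀ a → ¬ + (2+ q) ∣ a → a ^ℤ e 𝔽.≈ 1ℤ
  fermat a p∤a = *-cancelˡ (product∤ units (λ i → small∤ (ℕ.s≤s (Fin.toℕ<n i)))) (begin
    product units * a ^ℤ e                       ≡⟨ ℤ.*-comm (product units) (a ^ℤ e) ⟩
    a ^ℤ e * product units                       ≡⟨ product-scale {e} a units ⟨
    product {e} (λ i → a * units i)             ≈⟨ Π𝔽.sum-cong-≋ {e} (proj₂ permuted) ⟨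
    product {e} (λ i → units (proj₁ permuted ⟨$⟩ʳ i))
                                                ≈⟨ Π𝔽.sum-permute units (proj₁ permuted) ⟨
    product units                               ≡⟨ ℤ.*-identityʳ (product units) ⟨
    product units * 1ℤ                          ∎)
    where
    open SetoidReasoning 𝔽.setoid
    units : Fin e → ℤ
    units i = + suc (toℕ i)
    permuted : ∃[ π ] ∀ i → units (π ⟨$⟩ʳ i) 𝔽.≈ a * units i
    permuted = multiplication-permutes a (proj₁ (inverse a p∤a)) (proj₂ (inverse a p∤a))

  -- Rising factorials telescope, and y · (y+1)ₘ = (y+1)ₘ₊₁ − (m+1) (y+1)ₘ
  -- trades powers of y for longer rising factorials.
  power-rising-sum : ∀ k m → k ℕ.+ m ℕ.< e →
    sum {2+ q} (λ i → (+ toℕ i) ^ℤ k * rising (+ suc (toℕ i)) m) 𝔽.≈ 0ℤ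
  -- `suc m` is a unit because m < p - 1. Multiplied by it, the summand becomes a difference, and
  -- the sum over a full period telescopes to the values at p and 0, which agree modulo p.
  power-rising-sum zero m m<e = *-cancel-0 (small∤ (ℕ.s≤s m<e)) (begin
    + suc m * sum {2+ q} (λ i → 1ℤ * rising (+ suc (toℕ i)) m)
      ≡⟨ ℤ.+-identityˡ (+ suc m * sum {2+ q} (λ i → 1ℤ * rising (+ suc (toℕ i)) m)) ⟨
    0ℤ + + suc m * sum {2+ q} (λ i → 1ℤ * rising (+ suc (toℕ i)) m)
      ≈⟨ 𝔽.+-cong (𝔽.sym (Σ𝔽.sum-replicate-zero (2+ q))) 𝔽.refl ⟩
    sum {2+ q} (λ _ → 0ℤ) + + suc m * sum {2+ q} (λ i → 1ℤ * rising (+ suc (toℕ i)) m)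
      ≡⟨ sum-linear {2+ q} (+ suc m) (λ _ → 0ℤ) (λ i → 1ℤ * rising (+ suc (toℕ i)) m) ⟨
    sum {2+ q} (λ i → 0ℤ + + suc m * (1ℤ * rising (+ suc (toℕ i)) m))
      ≡⟨ Σ𝔽.sum-cong-≗ {2+ q} (λ i → ≡.trans (drop (+ suc m) (rising (+ suc (toℕ i)) m))
           (rising-difference (+ toℕ i) m)) ⟩
    sum {2+ q} (λ i → rising (+ suc (toℕ i)) (suc m) - rising (+ toℕ i) (suc m))
      ≡⟨ sum-telescope (2+ q) (λ i → rising (+ i) (suc m)) ⟩
    rising (+ (2+ q)) (suc m) - rising 0ℤ (suc m)
      ≈⟨ 𝔽.+-cong (rising-cong (suc m) p≈0) 𝔽.refl ⟩
    rising 0ℤ (suc m) - rising 0ℤ (suc m)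
      ≡⟨ ℤ.+-inverseʳ (rising 0ℤ (suc m)) ⟩
    0ℤ ∎)
    where
    open SetoidReasoning 𝔽.setoid
    drop : ∀ a b → 0ℤ + a * (1ℤ * b) ≡ a * b
    drop = solve-∀
  power-rising-sum (suc k) m k+m<e = begin
    sum {2+ q} (λ i → (+ toℕ i) ^ℤ suc k * rising (+ suc (toℕ i)) m)
      ≡⟨ Σ𝔽.sum-cong-≗ {2+ q} (λ i → pointwise (+ toℕ i) ((+ toℕ i) ^ℤ k) (rising (+ suc (toℕ i)) m) (+ m)) ⟩
    sum {2+ q} (λ i → (+ toℕ i) ^ℤ k * rising (+ suc (toℕ i)) (suc m)
                   + - (+ suc m) * ((+ toℕ i) ^ℤ k * rising (+ suc (toℕ i)) m))
      ≡⟨ sum-linear {2+ q} (- (+ suc m)) (λ i → (+ toℕ i) ^ℤ k * rising (+ suc (toℕ i)) (suc m))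
           (λ i → (+ toℕ i) ^ℤ k * rising (+ suc (toℕ i)) m) ⟩
    sum {2+ q} (λ i → (+ toℕ i) ^ℤ k * rising (+ suc (toℕ i)) (suc m))
    + - (+ suc m) * sum {2+ q} (λ i → (+ toℕ i) ^ℤ k * rising (+ suc (toℕ i)) m)
      ≈⟨ 𝔽.+-cong (power-rising-sum k (suc m) (subst (ℕ._< e) (≡.sym (ℕ.+-suc k m)) k+m<e))
           (𝔽.*-cong (𝔽.refl { - (+ suc m)}) (power-rising-sum k m (ℕ.<-trans (ℕ.n<1+n _) k+m<e))) ⟩
    0ℤ + - (+ suc m) * 0ℤ
      ≡⟨ ≡.trans (ℤ.+-identityˡ _) (ℤ.*-zeroʳ (- (+ suc m))) ⟩
    0ℤ ∎
    where
    open SetoidReasoning 𝔽.setoid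
    pointwise : ∀ y u r m → y * u * r ≡ u * (r * (1ℤ + y + m)) + - (1ℤ + m) * (u * r)
    pointwise = solve-∀

  -- A polynomial of degree below p - 1 sums to 0 over 𝔽ₚ; expanding one factor 1 - y at a time
  -- leads to pure powers.
  beta-vanishes : ∀ n m → n ℕ.+ m ℕ.< e → beta (2+ q) n m 𝔽.≈ 0ℤ
  beta-vanishes n zero    n+0<e = power-rising-sum n 0 n+0<e
  beta-vanishes n (suc m) n+m<e = begin
    beta (2+ q) n (suc m)                        ≡⟨ beta-recurrence (2+ q) n m ⟩
    beta (2+ q) n m + -1ℤ * beta (2+ q) (suc n) m     ≈⟨ 𝔽.+-cong (beta-vanishes n m (ℕ.<-trans (ℕ.n<1+n _) n+m<e′))
                                                 (𝔽.*-cong (𝔽.refl { -1ℤ}) (beta-vanishes (suc n) m n+m<e′)) ⟩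
    0ℤ                                      ∎
    where
    open SetoidReasoning 𝔽.setoid
    n+m<e′ : suc (n ℕ.+ m) ℕ.< e
    n+m<e′ = subst (ℕ._< e) (ℕ.+-suc n m) n+m<e

  -- By Fermat, (1 - y)^(p-1) is 1 except at y = 1, where it is 0. What remains is the vanishing
  -- power sum of y^n without its term 1 at y = 1.
  beta-top : ∀ n → n ℕ.< e → beta (2+ q) n e 𝔽.≈ -1ℤ
  beta-top n n<e = begin
    0ℤ ^ℤ n * 1ℤ ^ℤ e + (1ℤ ^ℤ n * 0ℤ ^ℤ e + sum {q} (λ i → y i ^ℤ n * (1ℤ - y i) ^ℤ e))
      ≈⟨ 𝔽.+-cong (𝔽.reflexive (cong (0ℤ ^ℤ n *_) (ℤ.^-zeroˡ e)))
           (𝔽.+-cong (𝔽.reflexive (cong (1ℤ ^ℤ n *_) (ℤ.*-zeroˡ (0ℤ ^ℤ q))))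
             (Σ𝔽.sum-cong-≋ {q} (λ i → 𝔽.*-cong (𝔽.refl {y i ^ℤ n}) (fermat (1ℤ - y i) (p∤1-y i))))) ⟩
    0ℤ ^ℤ n * 1ℤ + (1ℤ ^ℤ n * 0ℤ + sum {q} (λ i → y i ^ℤ n * 1ℤ))
      ≡⟨ cong (λ u → 0ℤ ^ℤ n * 1ℤ + (u * 0ℤ + sum {q} (λ i → y i ^ℤ n * 1ℤ))) (ℤ.^-zeroˡ n) ⟩
    0ℤ ^ℤ n * 1ℤ + (1ℤ * 0ℤ + sum {q} (λ i → y i ^ℤ n * 1ℤ))
      ≡⟨ rearrange (0ℤ ^ℤ n * 1ℤ) (sum {q} (λ i → y i ^ℤ n * 1ℤ)) ⟩
    0ℤ ^ℤ n * 1ℤ + (1ℤ * 1ℤ + sum {q} (λ i → y i ^ℤ n * 1ℤ)) + -1ℤ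
      ≡⟨ cong (λ u → 0ℤ ^ℤ n * 1ℤ + (u * 1ℤ + sum {q} (λ i → y i ^ℤ n * 1ℤ)) + -1ℤ) (ℤ.^-zeroˡ n) ⟨
    beta (2+ q) n 0 + -1ℤ
      ≈⟨ 𝔽.+-cong (beta-vanishes n 0 (subst (ℕ._< e) (≡.sym (ℕ.+-identityʳ n)) n<e)) (𝔽.refl { -1ℤ}) ⟩
    0ℤ + -1ℤ ∎
    where
    open SetoidReasoning 𝔽.setoid
    y : Fin q → ℤ
    y i = + suc (suc (toℕ i))
    rearrange : ∀ a b → a + (1ℤ * 0ℤ + b) ≡ a + (1ℤ * 1ℤ + b) + -1ℤ
    rearrange = solve-∀
    p∤1-y : ∀ i → ¬ + (2+ q) ∣ 1ℤ - y i
    p∤1-y i p∣1-y = small∤ {suc (toℕ i)} (ℕ.s<s (ℕ.<-trans (Fin.toℕ<n i) (ℕ.n<1+n q))) (∣ᵤ⇒∣ (∣⇒∣ᵤ p∣1-y))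

  -- B(a+j+1, m) = B(a+j, m) − B(a+j, m+1), where the terms on the right
  -- are instances with smaller a and with smaller j.
  beta-rising : ∀ a j m → a ℕ.< e → j ℕ.+ m ≡ e →
    rising 1ℤ j * -1ℤ ^ℤ j * beta (2+ q) (a ℕ.+ j) m 𝔽.≈ - rising (+ suc a) j
  beta-rising a zero m a<e refl = begin
    1ℤ * 1ℤ * beta (2+ q) (a ℕ.+ 0) e   ≡⟨ ℤ.*-identityˡ (beta (2+ q) (a ℕ.+ 0) e) ⟩
    beta (2+ q) (a ℕ.+ 0) e             ≈⟨ beta-top (a ℕ.+ 0) (subst (ℕ._< e) (≡.sym (ℕ.+-identityʳ a)) a<e) ⟩
    -1ℤ                            ∎
    where open SetoidReasoning 𝔽.setoid
  beta-rising a (suc j) m a<e j+m≡e = begin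
    rising 1ℤ (suc j) * -1ℤ ^ℤ suc j * beta (2+ q) (a ℕ.+ suc j) m
      ≡⟨ cong (rising 1ℤ (suc j) * -1ℤ ^ℤ suc j *_) recurrence ⟩
    r * (1ℤ + + j) * (-1ℤ * s) * (beta (2+ q) (a ℕ.+ j) m - X)
      ≡⟨ expand r (+ j) s (beta (2+ q) (a ℕ.+ j) m) X ⟩
    r * (1ℤ + + j) * (-1ℤ * s) * beta (2+ q) (a ℕ.+ j) m + (1ℤ + + j) * (r * s * X)
      ≈⟨ 𝔽.+-cong (previous a a<e) (𝔽.*-cong (𝔽.refl {1ℤ + + j}) (beta-rising a j (suc m) a<e (≡.trans (ℕ.+-suc j m) j+m≡e))) ⟩
    - (+ a * R) + (1ℤ + + j) * - R
      ≡⟨ collect (+ a) R (+ j) ⟩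
    - (R * (1ℤ + + a + + j)) ∎
    where
    open SetoidReasoning 𝔽.setoid
    r = rising 1ℤ j
    s = -1ℤ ^ℤ j
    X = beta (2+ q) (a ℕ.+ j) (suc m)
    R = rising (+ suc a) j
    solveX : ∀ u v → v ≡ u - (u + -1ℤ * v)
    solveX = solve-∀
    recurrence : beta (2+ q) (a ℕ.+ suc j) m ≡ beta (2+ q) (a ℕ.+ j) m - X
    recurrence = ≡.trans (cong (λ n → beta (2+ q) n m) (ℕ.+-suc a j))
      (≡.trans (solveX (beta (2+ q) (a ℕ.+ j) m) _)
        (cong (λ u → beta (2+ q) (a ℕ.+ j) m - u) (≡.sym (beta-recurrence (2+ q) (a ℕ.+ j) m))))
    expand : ∀ r j s Y X → r * (1ℤ + j) * (-1ℤ * s) * (Y - X)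
             ≡ r * (1ℤ + j) * (-1ℤ * s) * Y + (1ℤ + j) * (r * s * X)
    expand = solve-∀
    collect : ∀ a R j → - (a * R) + (1ℤ + j) * - R ≡ - (R * (1ℤ + a + j))
    collect = solve-∀
    previous : ∀ a → a ℕ.< e → rising 1ℤ (suc j) * -1ℤ ^ℤ suc j * beta (2+ q) (a ℕ.+ j) m 𝔽.≈ - (+ a * rising (+ suc a) j)
    -- At a = 0 the exponents add up to p - 2, so the sum vanishes, as does the factor `+ a` on the
    -- right.
    previous zero a<e = 𝔽.trans
      (𝔽.*-cong (𝔽.refl {rising 1ℤ (suc j) * -1ℤ ^ℤ suc j}) (beta-vanishes j m (ℕ.≤-reflexive j+m≡e)))
      (𝔽.zeroʳ (rising 1ℤ (suc j) * -1ℤ ^ℤ suc j))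
    previous (suc a) a<e = 𝔽.trans
      (𝔽.reflexive (cong (λ n → rising 1ℤ (suc j) * -1ℤ ^ℤ suc j * beta (2+ q) n m) (≡.sym (ℕ.+-suc a j))))
      (𝔽.trans (beta-rising a (suc j) m (ℕ.<-trans (ℕ.n<1+n a) a<e) j+m≡e)
        (𝔽.reflexive (cong -_ (rising-head (+ suc a) j))))

-- Units, divisibility by p and residues in the p-adic numbers

module Padics (q : ℕ) (p-prime : Prime (2+ q)) where

  open FiniteField q p-prime
  open Characters (2+ q) p-prime using (≈0⇒∣; ∣⇒≈0; Inverse-of; inverse)
  open PadicRat

  module Z = CommutativeRing (ℤₚ (2+ q))
  module Q = RawRing (ℚₚ (2+ q))
  module QΣ = RawSemiringDefs Q.rawSemiring

  pointwise : ∀ {a b : PadicInt (2+ q)} → (∀ n → approx a n ≡ approx b n) → a Z.≈ b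
  pointwise eq = levelwise λ n → ℤ/.reflexive ((2+ q) ℕ.^ n) (eq n)

  modulo-p : ∀ {a b} n → a ≈ b [mod (2+ q) ℕ.^ suc n ] → a 𝔽.≈ b
  modulo-p n = coarsen (ℕ.m∣m*n ((2+ q) ℕ.^ n))

  -- If cb = 1 + kp, then the inverse of c is b / (1 - w) with w = -kp, and the geometric series for
  -- 1 / (1 - w) converges p-adically: its first n terms are exact modulo p^n.
  lift-inverse : ∀ c → Inverse-of c → ∃[ c⁻¹ ] fromℤ (2+ q) c Z.* c⁻¹ Z.≈ Z.1#
  lift-inverse c (b , congruent (divides k cb-1≡kp)) = c⁻¹ , inverts
    where
    w : ℤ
    w = - k * + (2+ q)

    geometric : ℕ → ℤ
    geometric zero    = 0ℤ
    geometric (suc n) = 1ℤ + w * geometric n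

    geometric-step : ∀ n → geometric (suc n) - geometric n ≡ w ^ℤ n
    geometric-step zero    = cong (λ u → 1ℤ + u - 0ℤ) (ℤ.*-zeroʳ w)
    geometric-step (suc n) = ≡.trans (factor w (geometric (suc n)) (geometric n)) (cong (w *_) (geometric-step n))
      where
      factor : ∀ w g h → 1ℤ + w * g - (1ℤ + w * h) ≡ w * (g - h)
      factor = solve-∀

    geometric-sum : ∀ n → (1ℤ - w) * geometric n ≡ 1ℤ - w ^ℤ n
    geometric-sum zero    = ℤ.*-zeroʳ (1ℤ - w)
    geometric-sum (suc n) = ≡.trans (step w (geometric n)) (≡.trans
      (cong (λ u → 1ℤ - w + w * u) (geometric-sum n)) (collect w (w ^ℤ n)))
      where
      step : ∀ w g → (1ℤ - w) * (1ℤ + w * g) ≡ 1ℤ - w + w * ((1ℤ - w) * g)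
      step = solve-∀
      collect : ∀ w v → 1ℤ - w + w * (1ℤ - v) ≡ 1ℤ - w * v
      collect = solve-∀

    w^n : ∀ n → w ^ℤ n ≡ (- k) ^ℤ n * + ((2+ q) ℕ.^ n)
    w^n zero    = refl
    w^n (suc n) = ≡.trans (cong (w *_) (w^n n)) (≡.trans
      (swap (- k) (+ (2+ q)) ((- k) ^ℤ n) (+ ((2+ q) ℕ.^ n)))
      (cong ((- k) ^ℤ suc n *_) (≡.sym (ℤ.pos-* (2+ q) ((2+ q) ℕ.^ n)))))
      where
      swap : ∀ a b c d → a * b * (c * d) ≡ a * c * (b * d)
      swap = solve-∀

    c⁻¹ : PadicInt (2+ q)
    approx   c⁻¹ n = b * geometric n
    coherent c⁻¹ n = congruent (divides (b * (- k) ^ℤ n) (begin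
      b * geometric (suc n) - b * geometric n   ≡⟨ factor b (geometric (suc n)) (geometric n) ⟩
      b * (geometric (suc n) - geometric n)     ≡⟨ cong (b *_) (≡.trans (geometric-step n) (w^n n)) ⟩
      b * ((- k) ^ℤ n * + ((2+ q) ℕ.^ n))             ≡⟨ ℤ.*-assoc b ((- k) ^ℤ n) (+ ((2+ q) ℕ.^ n)) ⟨
      b * (- k) ^ℤ n * + ((2+ q) ℕ.^ n)               ∎))
      where
      open ≡.≡-Reasoning
      factor : ∀ b g h → b * g - b * h ≡ b * (g - h)
      factor = solve-∀

    1-w : c * b ≡ 1ℤ - w
    1-w = ≡.trans (restore (c * b)) (≡.trans (cong (λ u → 1ℤ + u) cb-1≡kp) (negate k (+ (2+ q))))
      where
      restore : ∀ x → x ≡ 1ℤ + (x - 1ℤ)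
      restore = solve-∀
      negate : ∀ k m → 1ℤ + k * m ≡ 1ℤ - - k * m
      negate = solve-∀

    inverts : fromℤ (2+ q) c Z.* c⁻¹ Z.≈ Z.1#
    inverts = levelwise λ n → congruent (divides (- ((- k) ^ℤ n)) (begin
      c * (b * geometric n) - 1ℤ       ≡⟨ cong (_- 1ℤ) (≡.trans (≡.sym (ℤ.*-assoc c b (geometric n)))
                                            (≡.trans (cong (_* geometric n) 1-w) (geometric-sum n))) ⟩
      1ℤ - w ^ℤ n - 1ℤ                  ≡⟨ cancel (w ^ℤ n) ⟩
      - (w ^ℤ n)                        ≡⟨ cong -_ (w^n n) ⟩
      - ((- k) ^ℤ n * + ((2+ q) ℕ.^ n))      ≡⟨ ℤ.neg-distribˡ-* ((- k) ^ℤ n) (+ ((2+ q) ℕ.^ n)) ⟩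
      - ((- k) ^ℤ n) * + ((2+ q) ℕ.^ n)      ∎))
      where
      open ≡.≡-Reasoning
      cancel : ∀ v → 1ℤ - v - 1ℤ ≡ - v
      cancel = solve-∀

  unit-inverse : ∀ c → ¬ + (2+ q) ∣ c → ∃[ c⁻¹ ] fromℤ (2+ q) c Z.* c⁻¹ Z.≈ Z.1#
  unit-inverse c p∤c = lift-inverse c (inverse c p∤c)

  -- Division by p costs one digit, so the n-th approximation of the quotient comes from the
  -- (n+1)-st of `a`. Level 1 decides divisibility because all higher levels agree with it modulo p;
  -- level 0 carries no information.
  divisible-by-p : ∀ a → approx a 1 𝔽.≈ 0ℤ → ∃[ z ] a Z.≈ fromℤ (2+ q) (+ (2+ q)) Z.* z
  divisible-by-p a a₁≈0 = z , levelwise λ n → ℤ/.trans ((2+ q) ℕ.^ n)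
      (ℤ/.sym ((2+ q) ℕ.^ n) (coherent a n))
      (ℤ/.reflexive ((2+ q) ℕ.^ n) (≡.trans (_∣_.equality (p∣ n)) (ℤ.*-comm (quotient n) (+ (2+ q)))))
    where
    aₙ₊₁≈0 : ∀ n → approx a (suc n) 𝔽.≈ 0ℤ
    aₙ₊₁≈0 zero    = a₁≈0
    aₙ₊₁≈0 (suc n) = 𝔽.trans (modulo-p n (coherent a (suc n))) (aₙ₊₁≈0 n)

    p∣ : ∀ n → + (2+ q) ∣ approx a (suc n)
    p∣ n = ≈0⇒∣ (aₙ₊₁≈0 n)

    quotient : ℕ → ℤ
    quotient n = _∣_.quotient (p∣ n)

    z : PadicInt (2+ q)
    approx   z n = quotient n
    coherent z n = congruent (*-cancelʳ-∣ (+ (2+ q)) (subst₂ _∣_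
      (≡.trans (ℤ.pos-* (2+ q) ((2+ q) ℕ.^ n)) (ℤ.*-comm (+ (2+ q)) (+ ((2+ q) ℕ.^ n))))
      (≡.trans (cong₂ _-_ (_∣_.equality (p∣ (suc n))) (_∣_.equality (p∣ n)))
        (factor (quotient (suc n)) (quotient n) (+ (2+ q))))
      (divisible (coherent a (suc n)))))
      where
      factor : ∀ a b m → a * m - b * m ≡ (a - b) * m
      factor = solve-∀

  -- u ∈ p⁻ⁿℤₚ, and pⁿu has residue r modulo p.
  record Reduces (n : ℕ) (u : PadicRat (2+ q)) (r : ℤ) : Set where
    constructor reduces
    field
      value    : PadicInt (2+ q)
      equation : num u Z.* fromℤ (2+ q) (+ ((2+ q) ℕ.^ n)) Z.≈ value Z.* den u
      reduct   : approx value 1 𝔽.≈ r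

  reduces-cong : ∀ {n u r s} → r 𝔽.≈ s → Reduces n u r → Reduces n u s
  reduces-cong r≈s (reduces a eq red) = reduces a eq (𝔽.trans red r≈s)

  reduces-fromℤₚ : ∀ {a r} → approx a 1 𝔽.≈ r → Reduces 0 (fromℤₚ (2+ q) a) r
  reduces-fromℤₚ {a} red = reduces a Z.refl red

  reduces-0 : ∀ {n} → Reduces n Q.0# 0ℤ
  reduces-0 = reduces Z.0# (pointwise λ _ → refl) 𝔽.refl

  reduces-* : ∀ {m n u v r s} → Reduces m u r → Reduces n v s → Reduces (m ℕ.+ n) (u Q.* v) (r * s)
  reduces-* {m} {n} {u} {v} (reduces a eqa reda) (reduces b eqb redb) = reduces (a Z.* b) (begin
    (num u Z.* num v) Z.* fromℤ (2+ q) (+ ((2+ q) ℕ.^ (m ℕ.+ n)))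
      ≈⟨ pointwise (λ k → ≡.trans
           (cong (approx (num u) k * approx (num v) k *_)
             (≡.trans (cong +_ (ℕ.^-distribˡ-+-* (2+ q) m n)) (ℤ.pos-* ((2+ q) ℕ.^ m) ((2+ q) ℕ.^ n))))
           (swap (approx (num u) k) (approx (num v) k) (+ ((2+ q) ℕ.^ m)) (+ ((2+ q) ℕ.^ n)))) ⟩
    (num u Z.* fromℤ (2+ q) (+ ((2+ q) ℕ.^ m))) Z.* (num v Z.* fromℤ (2+ q) (+ ((2+ q) ℕ.^ n)))
      ≈⟨ Z.*-cong eqa eqb ⟩
    (a Z.* den u) Z.* (b Z.* den v)
      ≈⟨ pointwise (λ k → swap (approx a k) (+ suc (den-1 u)) (approx b k) (+ suc (den-1 v))) ⟩
    (a Z.* b) Z.* den (u Q.* v) ∎) (𝔽.*-cong reda redb)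
    where
    open SetoidReasoning Z.setoid
    swap : ∀ a b c d → a * b * (c * d) ≡ a * c * (b * d)
    swap = solve-∀

  reduces-+ : ∀ {n u v r s} → Reduces n u r → Reduces n v s → Reduces n (u Q.+ v) (r + s)
  reduces-+ {n} {u} {v} (reduces a eqa reda) (reduces b eqb redb) = reduces (a Z.+ b) (begin
    num (u Q.+ v) Z.* P
      ≈⟨ pointwise (λ k → expand (approx (num u) k) (+ suc (den-1 u)) (approx (num v) k) (+ suc (den-1 v)) (+ ((2+ q) ℕ.^ n))) ⟩
    (num u Z.* P) Z.* den v Z.+ (num v Z.* P) Z.* den u
      ≈⟨ Z.+-cong (Z.*-congʳ eqa) (Z.*-congʳ eqb) ⟩
    (a Z.* den u) Z.* den v Z.+ (b Z.* den v) Z.* den u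
      ≈⟨ pointwise (λ k → collect (approx a k) (approx b k) (+ suc (den-1 u)) (+ suc (den-1 v))) ⟩
    (a Z.+ b) Z.* den (u Q.+ v) ∎) (𝔽.+-cong reda redb)
    where
    open SetoidReasoning Z.setoid
    P : PadicInt (2+ q)
    P = fromℤ (2+ q) (+ ((2+ q) ℕ.^ n))
    expand : ∀ u d v d′ P → (u * d′ + v * d) * P ≡ u * P * d′ + v * P * d
    expand = solve-∀
    collect : ∀ a b d d′ → a * d * d′ + b * d′ * d ≡ (a + b) * (d * d′)
    collect = solve-∀

  reduces-sum : ∀ {n N} {f : Fin N → PadicRat (2+ q)} {r : Fin N → ℤ} →
                (∀ i → Reduces n (f i) (r i)) → Reduces n (QΣ.sum f) (sum r)
  reduces-sum {N = zero}  red = reduces-0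
  reduces-sum {N = suc N} red = reduces-+ (red Fin.zero) (reduces-sum (λ i → red (Fin.suc i)))

  reduces-product : ∀ {N} {f : Fin N → PadicRat (2+ q)} {r : Fin N → ℤ} →
                    (∀ i → Reduces 1 (f i) (r i)) → Reduces N (QΣ.product f) (product r)
  reduces-product {zero}  red = reduces-fromℤₚ 𝔽.refl
  reduces-product {suc N} red = reduces-* (red Fin.zero) (reduces-product (λ i → red (Fin.suc i)))

  reduces-^ : ∀ {u r} n → Reduces 0 u r → Reduces 0 (u QΣ.^ n) (r ^ℤ n)
  reduces-^ zero    red = reduces-fromℤₚ 𝔽.refl
  reduces-^ (suc n) red = reduces-* red (reduces-^ n red)

  reduces-1/p : Reduces 1 (fromℚᵘ (2+ q) (1ℤ ℚᵘ./ (2+ q))) 1ℤ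
  reduces-1/p = reduces Z.1# (pointwise λ _ → cong (λ u → 1ℤ * + u) (ℕ.*-identityʳ (2+ q))) 𝔽.refl

  reduces-fraction : ∀ {n d-1 r} → ¬ + (2+ q) ∣ + suc d-1 → n 𝔽.≈ r * + suc d-1 →
                     Reduces 0 (fromℚᵘ (2+ q) (mkℚᵘ n d-1)) r
  reduces-fraction {n} {d-1} {r} p∤d n≈rd = reduces (fromℤ (2+ q) n Z.* d⁻¹)
    (begin
      fromℤ (2+ q) n Z.* Z.1#                               ≈⟨ Z.*-congˡ dd⁻¹≈1 ⟨
      fromℤ (2+ q) n Z.* (fromℤ (2+ q) (+ suc d-1) Z.* d⁻¹)      ≈⟨ pointwise (λ k → swap n (+ suc d-1) (approx d⁻¹ k)) ⟩
      fromℤ (2+ q) n Z.* d⁻¹ Z.* fromℤ (2+ q) (+ suc d-1)        ∎)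
    (𝔽.trans (𝔽.*-cong n≈rd (𝔽.refl {approx d⁻¹ 1}))
      (𝔽.trans (𝔽.reflexive (ℤ.*-assoc r (+ suc d-1) (approx d⁻¹ 1)))
        (𝔽.trans (𝔽.*-cong (𝔽.refl {r}) (modulo-p 0 (level dd⁻¹≈1 1))) (𝔽.*-identityʳ r))))
    where
    open SetoidReasoning Z.setoid
    d⁻¹ = proj₁ (unit-inverse (+ suc d-1) p∤d)
    dd⁻¹≈1 = proj₂ (unit-inverse (+ suc d-1) p∤d)
    swap : ∀ n d c → n * (d * c) ≡ n * c * d
    swap = solve-∀

  -- A sum of products of n + 1 binomials owes n + 1 powers of p: n are paid by the factor in front
  -- of Greene's function, the last by the p/(p-1) in its definition.
  reduces-clear : ∀ {n u r} → Reduces (suc n) u r →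
    Reduces 0 (fromℚᵘ (2+ q) (+ ((2+ q) ℕ.^ n) ℚᵘ./ 1) Q.* (fromℚᵘ (2+ q) (+ (2+ q) ℚᵘ./ e) Q.* u)) (- r)
  reduces-clear {n} {u} {r} (reduces a eqa reda) = reduces (a Z.* e⁻¹)
    (begin
      (fromℤ (2+ q) (+ ((2+ q) ℕ.^ n)) Z.* (fromℤ (2+ q) (+ (2+ q)) Z.* num u)) Z.* Z.1#
        ≈⟨ pointwise (λ k → ≡.trans (gather (+ ((2+ q) ℕ.^ n)) (+ (2+ q)) (approx (num u) k))
             (cong (approx (num u) k *_) (≡.sym (ℤ.pos-* (2+ q) ((2+ q) ℕ.^ n))))) ⟩
      num u Z.* fromℤ (2+ q) (+ ((2+ q) ℕ.^ suc n))
        ≈⟨ eqa ⟩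
      a Z.* den u
        ≈⟨ Z.*-identityˡ _ ⟨
      Z.1# Z.* (a Z.* den u)
        ≈⟨ Z.*-congʳ ee⁻¹≈1 ⟨
      fromℤ (2+ q) (+ e) Z.* e⁻¹ Z.* (a Z.* den u)
        ≈⟨ pointwise (λ k → regroup (+ e) (approx e⁻¹ k) (approx a k) (+ suc (den-1 u))) ⟩
      (a Z.* e⁻¹) Z.* den (fromℚᵘ (2+ q) (+ ((2+ q) ℕ.^ n) ℚᵘ./ 1) Q.* (fromℚᵘ (2+ q) (+ (2+ q) ℚᵘ./ e) Q.* u)) ∎)
    (𝔽.trans (𝔽.*-cong reda e⁻¹≈-1) (𝔽.reflexive (≡.trans (ℤ.*-comm r -1ℤ) (ℤ.-1*i≡-i r))))
    where
    open SetoidReasoning Z.setoid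
    e⁻¹ = proj₁ (unit-inverse (+ e) (small∤ (ℕ.n<1+n e)))
    ee⁻¹≈1 = proj₂ (unit-inverse (+ e) (small∤ (ℕ.n<1+n e)))
    gather : ∀ a b c → a * (b * c) * 1ℤ ≡ c * (b * a)
    gather = solve-∀
    regroup : ∀ e f a d → e * f * (a * d) ≡ a * f * (1ℤ * (e * d))
    regroup = solve-∀
    e⁻¹≈-1 : approx e⁻¹ 1 𝔽.≈ -1ℤ
    e⁻¹≈-1 = *-cancelˡ (small∤ (ℕ.n<1+n e)) (𝔽.trans (modulo-p 0 (level ee⁻¹≈1 1))
      (congruent (divides 1ℤ (closing (+ e)))))
      where
      closing : ∀ e → 1ℤ - e * -1ℤ ≡ 1ℤ * (1ℤ + e)
      closing = solve-∀

  reduces⇒≡ₚ : ∀ {u v r} → Reduces 0 u r → Reduces 0 v r → _≡ₚ_ (2+ q) u v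
  reduces⇒≡ₚ {u} {v} {r} (reduces a eqa reda) (reduces b eqb redb) = z , (begin
    (num u Z.* den v Z.+ (Z.- num v) Z.* den u) Z.* Z.1#
      ≈⟨ pointwise (λ k → expand (approx (num u) k) (+ suc (den-1 u)) (approx (num v) k) (+ suc (den-1 v))) ⟩
    (num u Z.* Z.1#) Z.* den v Z.+ Z.- ((num v Z.* Z.1#) Z.* den u)
      ≈⟨ Z.+-cong (Z.*-congʳ eqa) (Z.-‿cong (Z.*-congʳ eqb)) ⟩
    (a Z.* den u) Z.* den v Z.+ Z.- ((b Z.* den v) Z.* den u)
      ≈⟨ pointwise (λ k → collect (approx a k) (approx b k) (+ suc (den-1 u)) (+ suc (den-1 v))) ⟩
    (a Z.+ Z.- b) Z.* den (u Q.+ Q.- v)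
      ≈⟨ Z.*-congʳ a-b≈pz ⟩
    (fromℤ (2+ q) (+ (2+ q)) Z.* z) Z.* den (u Q.+ Q.- v) ∎)
    where
    open SetoidReasoning Z.setoid
    a-b≈0 : approx a 1 + - approx b 1 𝔽.≈ 0ℤ
    a-b≈0 = 𝔽.trans (𝔽.+-cong reda (𝔽.-‿cong redb)) (𝔽.reflexive (ℤ.+-inverseʳ r))
    z = proj₁ (divisible-by-p (a Z.+ Z.- b) a-b≈0)
    a-b≈pz = proj₂ (divisible-by-p (a Z.+ Z.- b) a-b≈0)
    expand : ∀ u d v d′ → (u * d′ + - v * d) * 1ℤ ≡ u * 1ℤ * d′ + - (v * 1ℤ * d)
    expand = solve-∀
    collect : ∀ a b d d′ → a * d * d′ + - (b * d′ * d) ≡ (a + - b) * (d * d′)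
    collect = solve-∀

-- Powers and the Teichmüller character

^-distrib-* : ∀ a b n → (a * b) ^ℤ n ≡ a ^ℤ n * b ^ℤ n
^-distrib-* a b zero    = refl
^-distrib-* a b (suc n) = ≡.trans (cong (a * b *_) (^-distrib-* a b n)) (swap a b (a ^ℤ n) (b ^ℤ n))
  where
  swap : ∀ a b c d → a * b * (c * d) ≡ a * c * (b * d)
  swap = solve-∀

0^n≡0 : ∀ n .{{_ : ℕ.NonZero n}} → 0ℤ ^ℤ n ≡ 0ℤ
0^n≡0 (suc n) = ℤ.*-zeroˡ (0ℤ ^ℤ n)

sum-ones : ∀ n → sum {n} (λ _ → 1ℤ) ≡ + n
sum-ones zero    = refl
sum-ones (suc n) = cong (λ u → 1ℤ + u) (sum-ones n)

binomial-mod-square : ∀ y z n → ∃[ w ] (y + z) ^ℤ suc n ≡ y ^ℤ suc n + + suc n * (y ^ℤ n * z) + z * z * w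
binomial-mod-square y z zero    = 0ℤ , base y z
  where
  base : ∀ y z → (y + z) * 1ℤ ≡ y * 1ℤ + 1ℤ * (1ℤ * z) + z * z * 0ℤ
  base = solve-∀
binomial-mod-square y z (suc n) with binomial-mod-square y z n
... | w , eq = y * w + + suc n * y ^ℤ n + z * w ,
  ≡.trans (cong ((y + z) *_) eq) (step y z (+ suc n) (y ^ℤ n) w)
  where
  step : ∀ y z N Y w → (y + z) * (y * Y + N * (Y * z) + z * z * w)
         ≡ y * (y * Y) + (1ℤ + N) * (y * Y * z) + z * z * (y * w + N * Y + z * w)
  step = solve-∀

module TeichmüllerCharacter (q : ℕ) (p-prime : Prime (2+ q)) where

  open FiniteField q p-prime
  open Padics q p-prime
  open Characters (2+ q) p-prime renaming (_^_ to _↑_; _^ᶻ_ to _↑ᶻ_)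

  module Ĝ = AbelianGroup characters
  module Mult = MonoidMult Ĝ.monoid
  module Ĝₚ = GroupProperties Ĝ.group

  -- A p-th power gains one p-adic digit: for x = y + z with z divisible by p^(n+1), the linear term
  -- acquires the factor p of the exponent, and z² is divisible by p^(2n+2), hence by p^(n+2).
  lift-congruence : ∀ {x y} n → x ≈ y [mod (2+ q) ℕ.^ suc n ] → x ^ℤ (2+ q) ≈ y ^ℤ (2+ q) [mod (2+ q) ℕ.^ suc (suc n) ]
  lift-congruence {x} {y} n (congruent (divides k x-y≡kP)) =
    congruent (divides (y ^ℤ e * k + k * k * P′ * w) (begin
      x ^ℤ (2+ q) - y ^ℤ (2+ q)
        ≡⟨ cong (λ u → u ^ℤ (2+ q) - y ^ℤ (2+ q)) x≡y+z ⟩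
      (y + z) ^ℤ (2+ q) - y ^ℤ (2+ q)
        ≡⟨ cong (_- y ^ℤ (2+ q)) (proj₂ (binomial-mod-square y z e)) ⟩
      y ^ℤ (2+ q) + + (2+ q) * (y ^ℤ e * z) + z * z * w - y ^ℤ (2+ q)
        ≡⟨ cong (λ u → y ^ℤ (2+ q) + + (2+ q) * (y ^ℤ e * (k * u)) + k * u * (k * u) * w - y ^ℤ (2+ q)) (ℤ.pos-* (2+ q) ((2+ q) ℕ.^ n)) ⟩
      y ^ℤ (2+ q) + + (2+ q) * (y ^ℤ e * (k * (+ (2+ q) * P′))) + k * (+ (2+ q) * P′) * (k * (+ (2+ q) * P′)) * w - y ^ℤ (2+ q)
        ≡⟨ collect (y ^ℤ (2+ q)) (+ (2+ q)) (y ^ℤ e) k P′ w ⟩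
      (y ^ℤ e * k + k * k * P′ * w) * (+ (2+ q) * (+ (2+ q) * P′))
        ≡⟨ cong ((y ^ℤ e * k + k * k * P′ * w) *_)
             (≡.trans (cong (+ (2+ q) *_) (≡.sym (ℤ.pos-* (2+ q) ((2+ q) ℕ.^ n)))) (≡.sym (ℤ.pos-* (2+ q) ((2+ q) ℕ.^ suc n)))) ⟩
      (y ^ℤ e * k + k * k * P′ * w) * + ((2+ q) ℕ.^ suc (suc n)) ∎))
    where
    open ≡.≡-Reasoning
    P′ z w : ℤ
    P′ = + ((2+ q) ℕ.^ n)
    z = k * + ((2+ q) ℕ.^ suc n)
    w = proj₁ (binomial-mod-square y z e)
    restore : ∀ x y → x ≡ y + (x - y)
    restore = solve-∀
    x≡y+z : x ≡ y + z
    x≡y+z = ≡.trans (restore x y) (cong (λ u → y + u) x-y≡kP)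
    collect : ∀ Y b E k P w → Y + b * (E * (k * (b * P))) + k * (b * P) * (k * (b * P)) * w - Y
              ≡ (E * k + k * k * P * w) * (b * (b * P))
    collect = solve-∀

  -- The gain of one digit, iterated n times. It makes the limit of a^(p^n) exist and depend on `a`
  -- only modulo p.
  lift-powers : ∀ {a b} n → a 𝔽.≈ b → a ^ℤ ((2+ q) ℕ.^ n) ≈ b ^ℤ ((2+ q) ℕ.^ n) [mod (2+ q) ℕ.^ suc n ]
  lift-powers {a} {b} zero    a≈b = coarsen (ℕ.∣-reflexive (ℕ.*-identityʳ (2+ q))) (^-cong 1 a≈b)
  lift-powers {a} {b} (suc n) a≈b = ℤ/.trans M (ℤ/.reflexive M (≡.sym (split a)))
    (ℤ/.trans M (lift-congruence n (lift-powers n a≈b)) (ℤ/.reflexive M (split b)))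
    where
    M = (2+ q) ℕ.^ suc (suc n)
    split : ∀ c → (c ^ℤ ((2+ q) ℕ.^ n)) ^ℤ (2+ q) ≡ c ^ℤ ((2+ q) ℕ.^ suc n)
    split c = ≡.trans (ℤ.^-*-assoc c ((2+ q) ℕ.^ n) (2+ q)) (cong (c ^ℤ_) (ℕ.*-comm ((2+ q) ℕ.^ n) (2+ q)))

  frobenius : ∀ a → a ^ℤ (2+ q) 𝔽.≈ a
  frobenius a with + (2+ q) ∣? a
  ... | yes p∣a = 𝔽.trans (^-cong (2+ q) (∣⇒≈0 p∣a)) (𝔽.trans (𝔽.reflexive (0^n≡0 (2+ q))) (𝔽.sym (∣⇒≈0 p∣a)))
  ... | no p∤a  = 𝔽.trans (𝔽.*-cong (𝔽.refl {a}) (fermat a p∤a)) (𝔽.*-identityʳ a)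

  p^n∣p^[1+n] : ∀ n → (2+ q) ℕ.^ n ℕ.∣ (2+ q) ℕ.^ suc n
  p^n∣p^[1+n] n = ℕ.n∣m*n (2+ q)

  -- The Teichmüller representative as the limit of a^(p^n). Consecutive terms agree even modulo
  -- p^(n+1), because a^(p^(n+1)) = (a^p)^(p^n) and a^p ≡ a; coherence asks for p^n.
  teichmüller : ℤ → PadicInt (2+ q)
  approx   (teichmüller a) n = a ^ℤ ((2+ q) ℕ.^ n)
  coherent (teichmüller a) n = coarsen (p^n∣p^[1+n] n) (ℤ/.trans ((2+ q) ℕ.^ suc n)
    (ℤ/.reflexive ((2+ q) ℕ.^ suc n) (≡.sym (ℤ.^-*-assoc a (2+ q) ((2+ q) ℕ.^ n))))
    (lift-powers n (frobenius a)))

  abstract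
    ω : Character
    ω = mkCharacter teichmüller
      (λ a≈b → levelwise λ n → coarsen (p^n∣p^[1+n] n) (lift-powers n a≈b))
      (λ a b → pointwise λ n → ^-distrib-* a b ((2+ q) ℕ.^ n))
      (pointwise λ n → ℤ.^-zeroˡ ((2+ q) ℕ.^ n))
      (pointwise λ n → 0^n≡0 ((2+ q) ℕ.^ n) {{ℕ.m^n≢0 (2+ q) n}})

    ω-reduct : ∀ a → approx (⟦ ω ⟧ a) 1 𝔽.≈ a
    ω-reduct a = 𝔽.trans (𝔽.reflexive (cong (a ^ℤ_) (ℕ.*-identityʳ (2+ q)))) (frobenius a)

  ext-ε-unit : ∀ {a} (a? : Dec (+ (2+ q) ∣ a)) → ¬ + (2+ q) ∣ a → ext-ε a? Z.≈ Z.1#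
  ext-ε-unit (yes p∣a) p∤a = contradiction p∣a p∤a
  ext-ε-unit (no _)    p∤a = Z.refl

  -- Restricted to nonzero residues on account of k = 0, where the character is `ε` and 0^0 = 1.
  ω↑-reduct : ∀ k a → ¬ + (2+ q) ∣ a → approx (⟦ ω ↑ k ⟧ a) 1 𝔽.≈ a ^ℤ k
  ω↑-reduct zero    a p∤a = modulo-p 0 (level (ext-ε-unit (+ (2+ q) ∣? a) p∤a) 1)
  ω↑-reduct (suc k) a p∤a = 𝔽.*-cong (ω-reduct a) (ω↑-reduct k a p∤a)

  -- With a positive exponent both sides vanish at 0, so this version can be summed over all of 𝔽ₚ.
  ω↑suc-reduct : ∀ k a → approx (⟦ ω ↑ suc k ⟧ a) 1 𝔽.≈ a ^ℤ suc k
  ω↑suc-reduct k a = cases (+ (2+ q) ∣? a)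
    where
    cases : Dec (+ (2+ q) ∣ a) → approx (⟦ ω ↑ suc k ⟧ a) 1 𝔽.≈ a ^ℤ suc k
    cases (no p∤a)  = ω↑-reduct (suc k) a p∤a
    cases (yes p∣a) = 𝔽.trans (modulo-p 0 (level (at-multiple (ω ↑ suc k) p∣a) 1))
      (𝔽.sym (𝔽.trans (^-cong (suc k) (∣⇒≈0 p∣a)) (𝔽.reflexive (0^n≡0 (suc k)))))

  ≈-on-units : ∀ A B → (∀ a → ¬ + (2+ q) ∣ a → ⟦ A ⟧ a Z.≈ ⟦ B ⟧ a) → A Ĝ.≈ B
  ≈-on-units A B A≈B a = cases (+ (2+ q) ∣? a)
    where
    cases : Dec (+ (2+ q) ∣ a) → ⟦ A ⟧ a Z.≈ ⟦ B ⟧ a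
    cases (yes p∣a) = Z.trans (at-multiple A p∣a) (Z.sym (at-multiple B p∣a))
    cases (no p∤a)  = A≈B a p∤a

  ↑-value : ∀ A k a → ¬ + (2+ q) ∣ a → ⟦ A ↑ k ⟧ a Z.≈ ⟦ A ⟧ (a ^ℤ k)
  ↑-value A zero    a p∤a = Z.trans (ext-ε-unit (+ (2+ q) ∣? a) p∤a) (Z.sym (Character.ε-homo A))
  ↑-value A (suc k) a p∤a = Z.trans (Z.*-cong Z.refl (↑-value A k a p∤a)) (Z.sym (Character.homo A a (a ^ℤ k)))

  ↑e≈ε : ∀ A → A ↑ e Ĝ.≈ ε
  ↑e≈ε A = ≈-on-units (A ↑ e) ε λ a p∤a →
    Z.trans (↑-value A e a p∤a) (Z.trans (Character.⟦⟧-cong A (fermat a p∤a))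
      (Z.trans (Character.ε-homo A) (Z.sym (ext-ε-unit (+ (2+ q) ∣? a) p∤a))))

  open SetoidReasoning Ĝ.setoid

  ε↑ : ∀ k → ε ↑ k Ĝ.≈ ε
  ε↑ zero    = Ĝ.refl {ε}
  ε↑ (suc k) = begin
    ε · ε ↑ k   ≈⟨ Ĝ.identityˡ (ε ↑ k) ⟩
    ε ↑ k       ≈⟨ ε↑ k ⟩
    ε           ∎

  ↑-multiple≈ε : ∀ A k → A ↑ (k ℕ.* e) Ĝ.≈ ε
  ↑-multiple≈ε A k = begin
    A ↑ (k ℕ.* e)   ≈⟨ Mult.×-assocˡ A k e ⟨
    (A ↑ e) ↑ k     ≈⟨ Mult.×-congʳ k {A ↑ e} {ε} (↑e≈ε A) ⟩
    ε ↑ k           ≈⟨ ε↑ k ⟩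
    ε               ∎

  ↑-periodic : ∀ A n k → A ↑ (n ℕ.+ k ℕ.* e) Ĝ.≈ A ↑ n
  ↑-periodic A n k = begin
    A ↑ (n ℕ.+ k ℕ.* e)     ≈⟨ Mult.×-homo-+ A n (k ℕ.* e) ⟩
    A ↑ n · A ↑ (k ℕ.* e)   ≈⟨ Ĝ.∙-congˡ {A ↑ n} {A ↑ (k ℕ.* e)} {ε} (↑-multiple≈ε A k) ⟩
    A ↑ n · ε               ≈⟨ Ĝ.identityʳ (A ↑ n) ⟩
    A ↑ n                   ∎

  ↑-congruent : ∀ A a b k l → a ℕ.+ k ℕ.* e ≡ b ℕ.+ l ℕ.* e → A ↑ a Ĝ.≈ A ↑ b
  ↑-congruent A a b k l eq = begin
    A ↑ a                   ≈⟨ ↑-periodic A a k ⟨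
    A ↑ (a ℕ.+ k ℕ.* e)     ≡⟨ cong (A ↑_) eq ⟩
    A ↑ (b ℕ.+ l ℕ.* e)     ≈⟨ ↑-periodic A b l ⟩
    A ↑ b                   ∎

  -- `q` is p - 2, and A^(p-1) = ε. This turns the integer powers in `IsGenerator` into natural
  -- ones.
  ⁻≈↑ : ∀ A → A ⁻ Ĝ.≈ A ↑ q
  ⁻≈↑ A = Ĝ.sym {A ↑ q} {A ⁻} (Ĝₚ.inverseʳ-unique A (A ↑ q) (↑e≈ε A))

  ↑ᶻ≈↑ : ∀ A n → ∃[ k ] A ↑ᶻ n Ĝ.≈ A ↑ k
  ↑ᶻ≈↑ A (+ n)    = n , Ĝ.refl {A ↑ n}
  ↑ᶻ≈↑ A -[1+ n ] = suc n ℕ.* q , (begin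
    (A ⁻) ↑ suc n       ≈⟨ Mult.×-congʳ (suc n) {A ⁻} {A ↑ q} (⁻≈↑ A) ⟩
    (A ↑ q) ↑ suc n     ≈⟨ Mult.×-assocˡ A (suc n) q ⟩
    A ↑ (suc n ℕ.* q)   ∎)

  -- If yᵏ = 1 for all nonzero y then Σ yᵏ = p − 1, whereas the power sums with
  -- exponent below p − 1 vanish.
  ω-order : ∀ k → suc k ℕ.< e → ¬ ω ↑ suc k Ĝ.≈ ε
  ω-order k k<e ω^k≈ε = small∤ (ℕ.n<1+n e) (≈0⇒∣ e≈0)
    where
    module 𝔽R = SetoidReasoning 𝔽.setoid
    y^k≈1 : ∀ (i : Fin e) → (+ suc (toℕ i)) ^ℤ suc k 𝔽.≈ 1ℤ
    y^k≈1 i = 𝔽.trans (𝔽.sym (ω↑-reduct (suc k) y p∤y))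
      (𝔽.trans (modulo-p 0 (level (ω^k≈ε y) 1)) (ω↑-reduct 0 y p∤y))
      where
      y : ℤ
      y = + suc (toℕ i)
      p∤y : ¬ + (2+ q) ∣ y
      p∤y = small∤ (ℕ.s≤s (Fin.toℕ<n i))
    e≈0 : + e 𝔽.≈ 0ℤ
    e≈0 = 𝔽R.begin
      + e                                                       𝔽R.≡⟨ sum-ones e ⟨
      sum {e} (λ _ → 1ℤ)                                        𝔽R.≈⟨ Σ𝔽.sum-cong-≋ {e} (λ i → 𝔽.trans (𝔽.*-identityʳ ((+ suc (toℕ i)) ^ℤ suc k)) (y^k≈1 i)) ⟨
      sum {e} (λ i → (+ suc (toℕ i)) ^ℤ suc k * 1ℤ)              𝔽R.≡⟨ ℤ.+-identityˡ _ ⟨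
      0ℤ + sum {e} (λ i → (+ suc (toℕ i)) ^ℤ suc k * 1ℤ)         𝔽R.≡⟨ cong (λ u → u * 1ℤ + sum {e} (λ i → (+ suc (toℕ i)) ^ℤ suc k * 1ℤ)) (0^n≡0 (suc k)) ⟨
      beta (2+ q) (suc k) 0                                          𝔽R.≈⟨ beta-vanishes (suc k) 0 (subst (ℕ._< e) (≡.sym (ℕ.+-identityʳ (suc k))) k<e) ⟩
      0ℤ                                                        𝔽R.∎

  ω↑-injective : ∀ {a b} → a ℕ.< e → b ℕ.< e → ω ↑ a Ĝ.≈ ω ↑ b → a ≡ b
  ω↑-injective {a} {b} a<e b<e ω^a≈ω^b = cases (ℕ.≤-total a b)
    where
    ordered : ∀ a b c → b ℕ.∸ a ≡ c → b ℕ.< e → a ℕ.≤ b → ω ↑ a Ĝ.≈ ω ↑ b → a ≡ b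
    ordered a b zero    b∸a≡c b<e a≤b _       = ℕ.≤-antisym a≤b (ℕ.m∸n≡0⇒m≤n b∸a≡c)
    ordered a b (suc c) b∸a≡c b<e a≤b ω^a≈ω^b = contradiction
      (Ĝₚ.identityʳ-unique (ω ↑ a) (ω ↑ suc c) (begin
        ω ↑ a · ω ↑ suc c     ≈⟨ Mult.×-homo-+ ω a (suc c) ⟨
        ω ↑ (a ℕ.+ suc c)     ≡⟨ cong (ω ↑_) (≡.trans (cong (a ℕ.+_) (≡.sym b∸a≡c)) (ℕ.m+[n∸m]≡n a≤b)) ⟩
        ω ↑ b                 ≈⟨ ω^a≈ω^b ⟨
        ω ↑ a                 ∎))
      (ω-order c (ℕ.≤-<-trans (subst (ℕ._≤ b) b∸a≡c (ℕ.m∸n≤m b a)) b<e))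
    cases : a ℕ.≤ b ⊎ b ℕ.≤ a → a ≡ b
    cases (inj₁ a≤b) = ordered a b (b ℕ.∸ a) refl b<e a≤b ω^a≈ω^b
    cases (inj₂ b≤a) = ≡.sym (ordered b a (a ℕ.∸ b) refl a<e b≤a (Ĝ.sym {ω ↑ a} {ω ↑ b} ω^a≈ω^b))

  -- All characters as powers of ω, by means of a generator

  module Generator (T : Character) (generates : IsGenerator T) where

    abstract
      discrete-log : ∀ χ → ∃[ n ] χ Ĝ.≈ T ↑ n
      discrete-log χ = from-ℤ (generates χ)
        where
        from-ℤ : ∃[ k ] χ Ĝ.≈ T ↑ᶻ k → ∃[ n ] χ Ĝ.≈ T ↑ n
        from-ℤ (k , χ≈T^k) = proj₁ (↑ᶻ≈↑ T k) ,
          Ĝ.trans {χ} {T ↑ᶻ k} {T ↑ proj₁ (↑ᶻ≈↑ T k)} χ≈T^k (proj₂ (↑ᶻ≈↑ T k))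

    -- The discrete logarithm of ω to the base T. What is wanted is T as a power of ω: its exponent
    -- `g` is an inverse of `m` modulo p - 1, which exists because ω has exact order p - 1.
    m : ℕ
    m = proj₁ (discrete-log ω)

    ω≈T^m : ω Ĝ.≈ T ↑ m
    ω≈T^m = proj₂ (discrete-log ω)

    ω↑≈T↑ : ∀ k → ω ↑ k Ĝ.≈ T ↑ (k ℕ.* m)
    ω↑≈T↑ k = begin
      ω ↑ k           ≈⟨ Mult.×-congʳ k {ω} {T ↑ m} ω≈T^m ⟩
      (T ↑ m) ↑ k     ≈⟨ Mult.×-assocˡ T k m ⟩
      T ↑ (k ℕ.* m)   ∎

    -- A common factor c of m and p − 1 would give ω an order dividing (p − 1) / c.
    coprime : Coprime m e
    coprime {zero}        (c∣m , ℕ.divides e′ e≡e′c) = contradiction (≡.trans e≡e′c (ℕ.*-zeroʳ e′)) λ ()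
    coprime {suc zero}    _ = refl
    coprime {suc (suc c)} (_ , ℕ.divides zero ())
    coprime {suc (suc c)} (ℕ.divides m′ m≡m′c , ℕ.divides (suc e′) e≡e′c) =
      contradiction (begin
        ω ↑ suc e′                                ≈⟨ ω↑≈T↑ (suc e′) ⟩
        T ↑ (suc e′ ℕ.* m)                        ≡⟨ cong (T ↑_) exponent ⟩
        T ↑ (m′ ℕ.* e)                            ≈⟨ ↑-multiple≈ε T m′ ⟩
        ε                                         ∎)
      (ω-order e′ (subst (suc e′ ℕ.<_) (≡.sym e≡e′c) (ℕ.m<m*n (suc e′) (suc (suc c)) (ℕ.s≤s (ℕ.s≤s ℕ.z≤n)))))
      where
      swap : ∀ a b c → a ℕ.* (b ℕ.* c) ≡ b ℕ.* (a ℕ.* c)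
      swap = ℕSolver.solve-∀
      exponent : suc e′ ℕ.* m ≡ m′ ℕ.* e
      exponent = ≡.trans (cong (suc e′ ℕ.*_) m≡m′c) (≡.trans (swap (suc e′) m′ (suc (suc c))) (cong (m′ ℕ.*_) (≡.sym e≡e′c)))

    bézout : Bézout.Identity 1 m e → ∃[ g ] ∃[ k ] ∃[ l ] g ℕ.* m ℕ.+ k ℕ.* e ≡ 1 ℕ.+ l ℕ.* e
    bézout (Bézout.+- x y eq) = x , 0 , y , ≡.trans (ℕ.+-identityʳ (x ℕ.* m)) (≡.sym eq)
    -- Here the coefficient of `m` would be -x; since q ≡ -1 modulo `e`, the natural number qx takes
    -- its place.
    bézout (Bézout.-+ x y eq) = q ℕ.* x , 1 , q ℕ.* y , ≡.trans (expand q x m)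
      (≡.trans (cong (λ u → 1 ℕ.+ q ℕ.* u) eq) (cong suc (≡.sym (ℕ.*-assoc q y e))))
      where
      expand : ∀ q x m → q ℕ.* x ℕ.* m ℕ.+ 1 ℕ.* (1 ℕ.+ q) ≡ 1 ℕ.+ q ℕ.* (1 ℕ.+ x ℕ.* m)
      expand = ℕSolver.solve-∀

    inverse-exponent⇒T≈ω↑ : ∀ g k l → g ℕ.* m ℕ.+ k ℕ.* e ≡ 1 ℕ.+ l ℕ.* e → T Ĝ.≈ ω ↑ g
    inverse-exponent⇒T≈ω↑ g k l eq = begin
      T                  ≈⟨ Mult.×-homo-1 T ⟨
      T ↑ 1              ≈⟨ ↑-congruent T (g ℕ.* m) 1 k l eq ⟨
      T ↑ (g ℕ.* m)      ≈⟨ ω↑≈T↑ g ⟨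
      ω ↑ g              ∎

    inverse-exponent⇒gm≈1 : ∀ g k l → g ℕ.* m ℕ.+ k ℕ.* e ≡ 1 ℕ.+ l ℕ.* e → + g * + m ≈ 1ℤ [mod e ]
    inverse-exponent⇒gm≈1 g k l eq = congruent (divides (+ l - + k) (≡.trans (isolate (+ g * + m) (+ k * + e))
      (≡.trans (cong (λ u → u - + k * + e - 1ℤ) eqℤ) (collect (+ l) (+ k) (+ e)))))
      where
      eqℤ : + g * + m + + k * + e ≡ 1ℤ + + l * + e
      eqℤ = ≡.trans (cong₂ _+_ (≡.sym (ℤ.pos-* g m)) (≡.sym (ℤ.pos-* k e)))
        (≡.trans (cong +_ eq) (cong (λ u → 1ℤ + u) (ℤ.pos-* l e)))
      isolate : ∀ a b → a - 1ℤ ≡ a + b - b - 1ℤ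
      isolate = solve-∀
      collect : ∀ l k e → 1ℤ + l * e - k * e - 1ℤ ≡ (l - k) * e
      collect = solve-∀

    abstract
      inverse-exponent : ∃[ g ] T Ĝ.≈ ω ↑ g × + g * + m ≈ 1ℤ [mod e ]
      inverse-exponent = from-identity (bézout (coprime-Bézout coprime))
        where
        from-identity : ∃[ g ] ∃[ k ] ∃[ l ] g ℕ.* m ℕ.+ k ℕ.* e ≡ 1 ℕ.+ l ℕ.* e →
                        ∃[ g ] T Ĝ.≈ ω ↑ g × + g * + m ≈ 1ℤ [mod e ]
        from-identity (g , k , l , eq) = g , inverse-exponent⇒T≈ω↑ g k l eq , inverse-exponent⇒gm≈1 g k l eq

    g : ℕ
    g = proj₁ inverse-exponent

    T≈ω^g : T Ĝ.≈ ω ↑ g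
    T≈ω^g = proj₁ (proj₂ inverse-exponent)

    gm≈1 : + g * + m ≈ 1ℤ [mod e ]
    gm≈1 = proj₂ (proj₂ inverse-exponent)

    T↑≈ω↑ : ∀ k → T ↑ k Ĝ.≈ ω ↑ (k ℕ.* g)
    T↑≈ω↑ k = begin
      T ↑ k           ≈⟨ Mult.×-congʳ k {T} {ω ↑ g} T≈ω^g ⟩
      (ω ↑ g) ↑ k     ≈⟨ Mult.×-assocˡ ω k g ⟩
      ω ↑ (k ℕ.* g)   ∎

    ω-log : ∀ χ → ∃[ k ] χ Ĝ.≈ ω ↑ toℕ {e} k
    ω-log χ = fromℕ< (ℕ.m%n<n (n ℕ.* g) e) , (begin
      χ                                                             ≈⟨ proj₂ (discrete-log χ) ⟩
      T ↑ n                                                         ≈⟨ T↑≈ω↑ n ⟩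
      ω ↑ (n ℕ.* g)                                                 ≡⟨ cong (ω ↑_) (ℕ.m≡m%n+[m/n]*n (n ℕ.* g) e) ⟩
      ω ↑ ((n ℕ.* g) ℕ.% e ℕ.+ (n ℕ.* g) ℕ./ e ℕ.* e)               ≈⟨ ↑-periodic ω ((n ℕ.* g) ℕ.% e) ((n ℕ.* g) ℕ./ e) ⟩
      ω ↑ ((n ℕ.* g) ℕ.% e)                                         ≡⟨ cong (ω ↑_) (Fin.toℕ-fromℕ< (ℕ.m%n<n (n ℕ.* g) e)) ⟨
      ω ↑ toℕ (fromℕ< (ℕ.m%n<n (n ℕ.* g) e))                        ∎)
      where
      n = proj₁ (discrete-log χ)

    -- The generator gives every character an exponent k < p - 1, and the order of ω makes it
    -- unique. A sum over any listing can thus be reindexed by k, and N = p - 1 follows.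
    listing-exponents : ∀ {N} (listing : Listing N) →
      ∃[ π ] ∀ j → Inverse.to listing j Ĝ.≈ ω ↑ toℕ {e} (π ⟨$⟩ʳ j)
    listing-exponents {N} listing = Perm.permutation log exp log-exp exp-log , λ j → proj₂ (ω-log (L.to j))
      where
      module L = Inverse listing
      log : Fin N → Fin e
      log j = proj₁ (ω-log (L.to j))
      exp : Fin e → Fin N
      exp k = L.from (ω ↑ toℕ k)
      log-exp : ∀ k → log (exp k) ≡ k
      log-exp k = Fin.toℕ-injective (ω↑-injective (Fin.toℕ<n (log (exp k))) (Fin.toℕ<n k) (begin
        ω ↑ toℕ (log (exp k))   ≈⟨ proj₂ (ω-log (L.to (exp k))) ⟨
        L.to (exp k)            ≈⟨ L.strictlyInverseˡ (ω ↑ toℕ k) ⟩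
        ω ↑ toℕ k               ∎))
      exp-log : ∀ j → exp (log j) ≡ j
      exp-log j = ≡.trans
        (L.from-cong {ω ↑ toℕ (log j)} {L.to j} (Ĝ.sym {L.to j} {ω ↑ toℕ (log j)} (proj₂ (ω-log (L.to j)))))
        (L.strictlyInverseʳ j)

-- Residues modulo p of the classical series and of Greene's summands

product-const : ∀ n c → product {n} (λ _ → c) ≡ c ^ℤ n
product-const zero    c = refl
product-const (suc n) c = cong (c *_) (product-const n c)

rising-1 : ∀ k → + (k ℕ.!) ≡ rising 1ℤ k
rising-1 zero    = refl
rising-1 (suc k) = ≡.trans (ℤ.pos-* (suc k) (k ℕ.!))
  (≡.trans (ℤ.*-comm (+ suc k) (+ (k ℕ.!))) (cong (_* + suc k) (rising-1 k)))

rising-vanishes : ∀ {m a} l k → l ℕ.< k → a + + l ≈ 0ℤ [mod m ] → rising a k ≈ 0ℤ [mod m ]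
rising-vanishes {m} {a} l (suc k) (ℕ.s≤s l≤k) a+l≈0 = cases (ℕ.m≤n⇒m<n∨m≡n l≤k)
  where
  module R = ℤ/ m
  cases : l ℕ.< k ⊎ l ≡ k → rising a (suc k) R.≈ 0ℤ
  cases (inj₁ l<k)  = R.trans (R.*-congʳ {a + + k} (rising-vanishes l k l<k a+l≈0)) (R.zeroˡ (a + + k))
  cases (inj₂ refl) = R.trans (R.*-congˡ {rising a k} a+l≈0) (R.zeroʳ (rising a k))

module Reduction (q : ℕ) (p-prime : Prime (2+ q)) where

  open FiniteField q p-prime
  open Padics q p-prime
  open TeichmüllerCharacter q p-prime
  open Characters (2+ q) p-prime renaming (_^_ to _↑_)

  inv′-unit : ∀ {a} (a? : Dec (+ (2+ q) ∣ a)) → ¬ + (2+ q) ∣ a → a * inv′ a? 𝔽.≈ 1ℤ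
  inv′-unit (yes p∣a) p∤a = contradiction p∣a p∤a
  inv′-unit {a} (no p∤a) _ = proj₂ (inverse a p∤a)

  rising-1∤ : ∀ k → k ℕ.< (2+ q) → ¬ + (2+ q) ∣ rising 1ℤ k
  rising-1∤ zero    _    p∣1 = p∤1 p∣1
  rising-1∤ (suc k) k+1<p p∣r with euclid (rising 1ℤ k) (+ suc k) p∣r
  ... | inj₁ p∣r′  = rising-1∤ k (ℕ.<-trans (ℕ.n<1+n k) k+1<p) p∣r′
  ... | inj₂ p∣k+1 = small∤ k+1<p p∣k+1

  abstract
    inv-factorial : ℕ → ℤ
    inv-factorial k = inv (rising 1ℤ k)

    factorial-inverse : ∀ k → k ℕ.< (2+ q) → rising 1ℤ k * inv-factorial k 𝔽.≈ 1ℤ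
    factorial-inverse k k<p = inv′-unit (+ (2+ q) ∣? rising 1ℤ k) (rising-1∤ k k<p)

  -- Rational numbers

  -- Elements of ℚᵘ are unreduced, so the condition concerns the representative at hand, whose
  -- written denominator must be prime to p. Cross-multiplication fixes the residue without a
  -- division in 𝔽ₚ.
  record ReducesQ (u : ℚᵘ) (r : ℤ) : Set where
    constructor reducesQ
    field
      p∤den  : ¬ + (2+ q) ∣ ↧ u
      num≈   : ↥ u 𝔽.≈ r * ↧ u

  reducesQ-integer : ∀ a → ReducesQ (a ℚᵘ./ 1) a
  reducesQ-integer a = reducesQ p∤1 (𝔽.sym (𝔽.*-identityʳ a))

  reducesQ-* : ∀ {u v r s} → ReducesQ u r → ReducesQ v s → ReducesQ (u ℚᵘ.* v) (r * s)
  reducesQ-* {u@(mkℚᵘ _ _)} {v@(mkℚᵘ _ _)} {r} {s} (reducesQ p∤u equ) (reducesQ p∤v eqv) = reducesQ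
    (λ p∣uv → [ p∤u , p∤v ]′ (euclid (↧ u) (↧ v) p∣uv))
    (𝔽.trans (𝔽.*-cong equ eqv) (𝔽.reflexive (swap r (↧ u) s (↧ v))))
    where
    swap : ∀ a b c d → a * b * (c * d) ≡ a * c * (b * d)
    swap = solve-∀

  reducesQ-+ : ∀ {u v r s} → ReducesQ u r → ReducesQ v s → ReducesQ (u ℚᵘ.+ v) (r + s)
  reducesQ-+ {u@(mkℚᵘ _ _)} {v@(mkℚᵘ _ _)} {r} {s} (reducesQ p∤u equ) (reducesQ p∤v eqv) = reducesQ
    (λ p∣uv → [ p∤u , p∤v ]′ (euclid (↧ u) (↧ v) p∣uv))
    (𝔽.trans (𝔽.+-cong (𝔽.*-congʳ {↧ v} equ) (𝔽.*-congʳ {↧ u} eqv)) (𝔽.reflexive (collect r (↧ u) s (↧ v))))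
    where
    collect : ∀ a b c d → a * b * d + c * d * b ≡ (a + c) * (b * d)
    collect = solve-∀

  -- As `r` is a unit, the numerator is prime to p: it can serve as the new denominator, and the
  -- default value of `recip` at 0 never occurs.
  reducesQ-recip : ∀ {u r s} → r * s 𝔽.≈ 1ℤ → ReducesQ u r → ReducesQ (recip u) s
  reducesQ-recip {u} {r} {s} rs≈1 (reducesQ p∤u equ) = cases u p∤u den≈
    where
    den≈ : ↧ u 𝔽.≈ s * ↥ u
    den≈ = 𝔽.sym (𝔽.trans (𝔽.*-congˡ {s} equ) (𝔽.trans (𝔽.reflexive (regroup s r (↧ u)))
      (𝔽.trans (𝔽.*-congʳ {↧ u} rs≈1) (𝔽.*-identityˡ (↧ u)))))
      where
      regroup : ∀ s r d → s * (r * d) ≡ r * s * d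
      regroup = solve-∀
    p∤num : ∀ {n d} → ¬ + (2+ q) ∣ d → d 𝔽.≈ s * n → ¬ + (2+ q) ∣ n
    p∤num {n} {d} p∤d d≈sn p∣n = p∤d (∣-resp (𝔽.sym d≈sn) (∣-*ʳ s p∣n))
    cases : ∀ u → ¬ + (2+ q) ∣ ↧ u → ↧ u 𝔽.≈ s * ↥ u → ReducesQ (recip u) s
    cases (mkℚᵘ +0 d-1)       p∤d d≈sn = contradiction (divides 0ℤ refl) (p∤num p∤d d≈sn)
    cases (mkℚᵘ +[1+ n ] d-1) p∤d d≈sn = reducesQ (p∤num p∤d d≈sn) d≈sn
    cases (mkℚᵘ -[1+ n ] d-1) p∤d d≈sn = reducesQ
      (λ p∣n → p∤num p∤d d≈sn (∣ᵤ⇒∣ (∣⇒∣ᵤ p∣n)))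
      (𝔽.trans (𝔽.-‿cong d≈sn) (𝔽.reflexive (ℤ.neg-distribʳ-* s -[1+ n ])))

  reducesQ-sum : ∀ {N} {f : Fin N → ℚᵘ} {r : Fin N → ℤ} →
                 (∀ i → ReducesQ (f i) (r i)) → ReducesQ (ℚΣ.sum f) (sum r)
  reducesQ-sum {zero}  red = reducesQ-integer 0ℤ
  reducesQ-sum {suc N} red = reducesQ-+ (red Fin.zero) (reducesQ-sum (λ i → red (Fin.suc i)))

  reducesQ-product : ∀ {N} {f : Fin N → ℚᵘ} {r : Fin N → ℤ} →
                     (∀ i → ReducesQ (f i) (r i)) → ReducesQ (ℚΣ.product f) (product r)
  reducesQ-product {zero}  red = reducesQ-integer 1ℤ
  reducesQ-product {suc N} red = reducesQ-* (red Fin.zero) (reducesQ-product (λ i → red (Fin.suc i)))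

  reducesQ-^ : ∀ {u r} n → ReducesQ u r → ReducesQ (u ℚΣ.^ n) (r ^ℤ n)
  reducesQ-^ zero    red = reducesQ-integer 1ℤ
  reducesQ-^ (suc n) red = reducesQ-* red (reducesQ-^ n red)

  reducesQ-poch : ∀ {u r} k → ReducesQ u r → ReducesQ (poch u k) (rising r k)
  reducesQ-poch zero    red = reducesQ-integer 1ℤ
  reducesQ-poch (suc k) red = reducesQ-* (reducesQ-poch k red) (reducesQ-+ red (reducesQ-integer (+ k)))

  reduces-fromℚᵘ : ∀ {u r} → ReducesQ u r → Reduces 0 (fromℚᵘ (2+ q) u) r
  reduces-fromℚᵘ {mkℚᵘ n d-1} (reducesQ p∤d n≈rd) = reduces-fraction p∤d n≈rd

  -- The residue of the k-th summand of either series, up to sign. Besides n upper parameters there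
  -- are n - 1 lower parameters 1 and the factorial, whence the denominator k!^n.
  term : ∀ {n} → (Fin n → ℤ) → ℤ → ℕ → ℤ
  term {n} c x k = product (λ i → rising (c i) k) * inv-factorial k ^ℤ n * x ^ℤ k

  reducesQ-truncated : ∀ {n} (a : Vector ℚᵘ (suc n)) (c : Fin (suc n) → ℤ) x →
    (∀ i → ReducesQ (a i) (c i)) →
    ReducesQ (truncated a (λ _ → 1ℚᵘ) x (2+ q)) (sum {2+ q} (λ k → term c x (toℕ k)))
  reducesQ-truncated {n} a c x red = reducesQ-sum {2+ q} λ i → reducesQ-term (toℕ i) (Fin.toℕ<n i)
    where
    reducesQ-term : ∀ k → k ℕ.< (2+ q) → ReducesQ
      (ℚΣ.product (λ j → poch (a j) k) ℚᵘ.*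
       recip (ℚΣ.product {n} (λ _ → poch 1ℚᵘ k) ℚᵘ.* (+ (k ℕ.!) ℚᵘ./ 1)) ℚᵘ.*
       ((x ℚᵘ./ 1) ℚΣ.^ k)) (term c x k)
    reducesQ-term k k<p = reducesQ-*
      (reducesQ-* (reducesQ-product (λ i → reducesQ-poch k (red i)))
        (reducesQ-recip (begin
            product {n} (λ _ → f) * + (k ℕ.!) * s ^ℤ suc n  ≡⟨ cong₂ (λ u v → u * v * s ^ℤ suc n) (product-const n f) (rising-1 k) ⟩
            f ^ℤ n * f * s ^ℤ suc n                          ≡⟨ cong (_* s ^ℤ suc n) (ℤ.*-comm (f ^ℤ n) f) ⟩
            f ^ℤ suc n * s ^ℤ suc n                          ≡⟨ ^-distrib-* f s (suc n) ⟨
            (f * s) ^ℤ suc n                                ≈⟨ ^-cong (suc n) (factorial-inverse k k<p) ⟩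
            1ℤ ^ℤ suc n                                     ≡⟨ ℤ.^-zeroˡ (suc n) ⟩
            1ℤ                                             ∎)
          (reducesQ-* (reducesQ-product {n} (λ _ → reducesQ-poch k (reducesQ-integer 1ℤ))) (reducesQ-integer (+ (k ℕ.!))))))
      (reducesQ-^ k (reducesQ-integer x))
      where
      open SetoidReasoning 𝔽.setoid
      f s : ℤ
      f = rising 1ℤ k
      s = inv-factorial k

  -- Greene's functions

  -- `A` and `B ⁻` are evaluated at every residue, 0 included, so they must be power maps
  -- everywhere. `B` itself is evaluated at -1 only; passing that value separately covers B = ε.
  reduces-binom : ∀ A B n m {b} →
    (∀ y → approx (⟦ A ⟧ y) 1 𝔽.≈ y ^ℤ n) → (∀ y → approx (⟦ B ⁻ ⟧ y) 1 𝔽.≈ y ^ℤ m) →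
    approx (⟦ B ⟧ -1ℤ) 1 𝔽.≈ b → Reduces 1 (binom A B) (b * beta (2+ q) n m)
  reduces-binom A B n m {b} A≈ B⁻≈ B-1≈ = reduces-cong
    (𝔽.reflexive (cong (_* beta (2+ q) n m) (ℤ.*-identityʳ b)))
    (reduces-* {1} {0} (reduces-* {0} {1} (reduces-fromℤₚ B-1≈) reduces-1/p)
      (reduces-sum {0} {2+ q} {λ i → value A (+ toℕ i) Q.* value (B ⁻) (1ℤ - + toℕ i)} {λ i → (+ toℕ i) ^ℤ n * (1ℤ - + toℕ i) ^ℤ m}
        (λ i → reduces-* {0} {0} {value A (+ toℕ i)} {value (B ⁻) (1ℤ - + toℕ i)}
          (reduces-fromℤₚ (A≈ (+ toℕ i))) (reduces-fromℤₚ (B⁻≈ (1ℤ - + toℕ i))))))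

  reduct-cong : ∀ {A B : Character} {a r} → A Ĝ.≈ B → approx (⟦ B ⟧ a) 1 𝔽.≈ r → approx (⟦ A ⟧ a) 1 𝔽.≈ r
  reduct-cong {a = a} A≈B = 𝔽.trans (modulo-p 0 (level (A≈B a) 1))

  p∤-1 : ¬ + (2+ q) ∣ -1ℤ
  p∤-1 p∣-1 = p∤1 (∣ᵤ⇒∣ (∣⇒∣ᵤ p∣-1))

  jacobi-residue : ∀ a k m {c} → a ℕ.< e → k ℕ.< e → k ℕ.+ m ≡ e → + suc a 𝔽.≈ c →
    -1ℤ ^ℤ k * beta (2+ q) (a ℕ.+ k) m 𝔽.≈ -1ℤ * (inv-factorial k * rising c k)
  jacobi-residue a k m {c} a<e k<e k+m≡e c≈ = begin
    X                                         ≡⟨ ℤ.*-identityˡ X ⟨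
    1ℤ * X                                    ≈⟨ 𝔽.*-congʳ {X} (factorial-inverse k (ℕ.<-trans k<e (ℕ.n<1+n e))) ⟨
    f * s * (-1ℤ ^ℤ k * b)                     ≡⟨ regroup f s (-1ℤ ^ℤ k) b ⟩
    s * (f * -1ℤ ^ℤ k * b)                     ≈⟨ 𝔽.*-congˡ {s} (beta-rising a k m a<e k+m≡e) ⟩
    s * - rising (+ suc a) k                  ≈⟨ 𝔽.*-congˡ {s} (𝔽.-‿cong (rising-cong k c≈)) ⟩
    s * - rising c k                          ≡⟨ negate s (rising c k) ⟩
    -1ℤ * (s * rising c k)                    ∎
    where
    open SetoidReasoning 𝔽.setoid
    f s b X : ℤ
    f = rising 1ℤ k
    s = inv-factorial k
    b = beta (2+ q) (a ℕ.+ k) m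
    X = -1ℤ ^ℤ k * b
    regroup : ∀ f s u b → f * s * (u * b) ≡ s * (f * u * b)
    regroup = solve-∀
    negate : ∀ s r → s * - r ≡ -1ℤ * (s * r)
    negate = solve-∀

  ·≈ω↑ : ∀ A χ a k → A Ĝ.≈ ω ↑ a → χ Ĝ.≈ ω ↑ k → A · χ Ĝ.≈ ω ↑ (a ℕ.+ k)
  ·≈ω↑ A χ a k A≈ χ≈ = begin
    A · χ             ≈⟨ Ĝ.∙-cong {A} {ω ↑ a} {χ} {ω ↑ k} A≈ χ≈ ⟩
    ω ↑ a · ω ↑ k     ≈⟨ Mult.×-homo-+ ω a k ⟨
    ω ↑ (a ℕ.+ k)     ∎
    where open SetoidReasoning Ĝ.setoid

  ⁻≈ω↑ : ∀ A k m → A Ĝ.≈ ω ↑ k → k ℕ.+ m ≡ e → A ⁻ Ĝ.≈ ω ↑ m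
  ⁻≈ω↑ A k m A≈ k+m≡e = Ĝ.sym {ω ↑ m} {A ⁻} (Ĝₚ.inverseʳ-unique A (ω ↑ m) (begin
    A · ω ↑ m           ≈⟨ ·≈ω↑ A (ω ↑ m) k m A≈ (Ĝ.refl {ω ↑ m}) ⟩
    ω ↑ (k ℕ.+ m)       ≡⟨ cong (ω ↑_) k+m≡e ⟩
    ω ↑ e               ≈⟨ ↑e≈ε ω ⟩
    ε                   ∎))
    where open SetoidReasoning Ĝ.setoid

  -- The exponent of `A` is `suc a`, so the rising factorial starts at `suc (suc a)`. `B` is kept
  -- apart from χ because Greene's function has χ in its first binomial and `ε · χ` in the others.
  reduces-jacobi : ∀ A B χ a c k → A Ĝ.≈ ω ↑ suc a → χ Ĝ.≈ ω ↑ k → B Ĝ.≈ χ →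
    suc a ℕ.< e → k ℕ.< e → + suc (suc a) 𝔽.≈ c →
    Reduces 1 (binom (A · χ) B) (-1ℤ * (inv-factorial k * rising c k))
  reduces-jacobi A B χ a c k A≈ χ≈ B≈χ a<e k<e c≈ = reduces-cong
    (jacobi-residue (suc a) k (suc m) a<e k<e k+m≡e c≈)
    (reduces-binom (A · χ) B (suc a ℕ.+ k) (suc m)
      (λ y → reduct-cong {A · χ} {ω ↑ suc (a ℕ.+ k)} (·≈ω↑ A χ (suc a) k A≈ χ≈) (ω↑suc-reduct (a ℕ.+ k) y))
      (λ y → reduct-cong {B ⁻} {ω ↑ suc m} (⁻≈ω↑ B k (suc m) B≈ω^k k+m≡e) (ω↑suc-reduct m y))
      (reduct-cong {B} {ω ↑ k} B≈ω^k (ω↑-reduct k -1ℤ p∤-1)))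
    where
    -- The conjugate of ω^k becomes ω^(suc m) with suc m = p - 1 - k, which is positive even for the
    -- largest k and equals p - 1 at k = 0.
    m : ℕ
    m = q ℕ.∸ k

    k+m≡e : k ℕ.+ suc m ≡ e
    k+m≡e = ≡.trans (ℕ.+-suc k m) (cong suc (ℕ.m+[n∸m]≡n (ℕ.≤-pred k<e)))

    B≈ω^k : B Ĝ.≈ ω ↑ k
    B≈ω^k = Ĝ.trans {B} {χ} {ω ↑ k} B≈χ χ≈

  reduces-greene-term : ∀ {n} (A : Vector Character (suc n)) (a : Fin (suc n) → ℕ) (c : Fin (suc n) → ℤ) x χ k →
    ¬ + (2+ q) ∣ x → (∀ i → A i Ĝ.≈ ω ↑ suc (a i)) → (∀ i → suc (a i) ℕ.< e) → (∀ i → + suc (suc (a i)) 𝔽.≈ c i) →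
    χ Ĝ.≈ ω ↑ k → k ℕ.< e →
    Reduces (suc n) (binom (head A · χ) χ Q.* QΣ.product (λ i → binom (tail A i · χ) (ε · χ)) Q.* value χ x)
      (-1ℤ ^ℤ suc n * term c x k)
  reduces-greene-term {n} A a c x χ k p∤x A≈ a<e c≈ χ≈ k<e = reduces-cong (𝔽.reflexive signs)
    (subst (λ N → Reduces N u r) (ℕ.+-identityʳ (suc n))
      (reduces-* {suc n} {0}
        (reduces-* {1} {n} (factor Fin.zero χ (Ĝ.refl {χ}))
          (reduces-product (λ i → factor (Fin.suc i) (ε · χ) (Ĝ.identityˡ χ))))
        (reduces-fromℤₚ (reduct-cong {χ} {ω ↑ k} χ≈ (ω↑-reduct k x p∤x)))))
    where
    s r : ℤ
    s = inv-factorial k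
    r = product {suc n} (λ i → -1ℤ * (s * rising (c i) k)) * x ^ℤ k
    u : PadicRat (2+ q)
    u = binom (head A · χ) χ Q.* QΣ.product (λ i → binom (tail A i · χ) (ε · χ)) Q.* value χ x
    factor : ∀ i B → B Ĝ.≈ χ → Reduces 1 (binom (A i · χ) B) (-1ℤ * (s * rising (c i) k))
    factor i B B≈χ = reduces-jacobi (A i) B χ (a i) (c i) k (A≈ i) χ≈ B≈χ (a<e i) k<e (c≈ i)
    signs : r ≡ -1ℤ ^ℤ suc n * term c x k
    signs = ≡.trans (cong (_* x ^ℤ k) (≡.trans (product-scale {suc n} -1ℤ (λ i → s * rising (c i) k))
      (cong (-1ℤ ^ℤ suc n *_) (product-scale {suc n} s (λ i → rising (c i) k)))))
      (regroup (-1ℤ ^ℤ suc n) (s ^ℤ suc n) (product {suc n} (λ i → rising (c i) k)) (x ^ℤ k))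
      where
      regroup : ∀ m s r x → m * (s * r) * x ≡ m * (r * s * x)
      regroup = solve-∀

-- Comparison of the two residues

module Comparison (q : ℕ) (p-prime : Prime (2+ q)) where

  open FiniteField q p-prime
  open Padics q p-prime
  open TeichmüllerCharacter q p-prime
  open Reduction q p-prime
  open Characters (2+ q) p-prime renaming (_^_ to _↑_)

  -- The truncated series has p terms, but there are only p - 1 characters. Since l < p - 1, the
  -- surplus term k = p - 1 contains the factor c₀ + l ≡ 0.
  term-sum-truncates : ∀ {n} (c : Fin (suc n) → ℤ) x l → l ℕ.< e → c Fin.zero + + l 𝔽.≈ 0ℤ →
    sum {2+ q} (λ k → term c x (toℕ k)) 𝔽.≈ sum {e} (λ k → term c x (toℕ k))
  term-sum-truncates {n} c x l l<e c+l≈0 = begin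
    sum {2+ q} (λ k → V (toℕ k))
      ≈⟨ Σ𝔽.sum-init-last {e} (λ k → V (toℕ k)) ⟩
    sum {e} (λ k → V (toℕ (Fin.inject₁ k))) + V (toℕ (Fin.fromℕ e))
      ≡⟨ cong₂ _+_ (Σ𝔽.sum-cong-≗ {e} (λ k → cong V (Fin.toℕ-inject₁ k))) (cong V (Fin.toℕ-fromℕ e)) ⟩
    sum {e} (λ k → V (toℕ k)) + V e
      ≈⟨ 𝔽.+-congˡ {sum {e} (λ k → V (toℕ k))} last≈0 ⟩
    sum {e} (λ k → V (toℕ k)) + 0ℤ
      ≡⟨ ℤ.+-identityʳ _ ⟩
    sum {e} (λ k → V (toℕ k)) ∎
    where
    open SetoidReasoning 𝔽.setoid
    V : ℕ → ℤ
    V = term c x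
    rest : ℤ
    rest = product {n} (λ i → rising (c (Fin.suc i)) e)
    last≈0 : V e 𝔽.≈ 0ℤ
    last≈0 = 𝔽.trans
      (𝔽.*-congʳ {x ^ℤ e} (𝔽.*-congʳ {inv-factorial e ^ℤ suc n} (𝔽.*-congʳ {rest} (rising-vanishes l e l<e c+l≈0))))
      (𝔽.reflexive (annihilate rest (inv-factorial e ^ℤ suc n) (x ^ℤ e)))
      where
      annihilate : ∀ a b c → 0ℤ * a * b * c ≡ 0ℤ
      annihilate = solve-∀

  term-permute : ∀ {n} (c : Fin n → ℤ) x (π : Permutation n n) k →
    term (λ i → c (π ⟨$⟩ʳ i)) x k 𝔽.≈ term c x k
  term-permute {n} c x π k = 𝔽.*-congʳ {x ^ℤ k} (𝔽.*-congʳ {inv-factorial k ^ℤ n}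
    (𝔽.sym (Π𝔽.sum-permute (λ i → rising (c i) k) π)))

  module _ (T : Character) (generates : IsGenerator T) where

    open Generator T generates

    reduces-greene : ∀ {n N} (listing : Listing N) (A : Vector Character (suc n))
      (a : Fin (suc n) → ℕ) (c : Fin (suc n) → ℤ) x → ¬ + (2+ q) ∣ x →
      (∀ i → A i Ĝ.≈ ω ↑ suc (a i)) → (∀ i → suc (a i) ℕ.< e) → (∀ i → + suc (suc (a i)) 𝔽.≈ c i) →
      Reduces 0 (fromℚᵘ (2+ q) (+ ((2+ q) ℕ.^ n) ℚᵘ./ 1) Q.* greene listing A (λ _ → ε) x)
        (-1ℤ ^ℤ suc (suc n) * sum {e} (λ k → term c x (toℕ k)))
    reduces-greene {n} {N} listing A a c x p∤x A≈ a<e c≈ = reduces-cong residue≈ (reduces-clear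
      (reduces-sum λ j → reduces-greene-term A a c x (Inverse.to listing j) (toℕ (π ⟨$⟩ʳ j))
        p∤x A≈ a<e c≈ (proj₂ exponents j) (Fin.toℕ<n (π ⟨$⟩ʳ j))))
      where
      open SetoidReasoning 𝔽.setoid
      exponents = listing-exponents listing
      π = proj₁ exponents
      V : ℕ → ℤ
      V k = -1ℤ ^ℤ suc n * term c x k
      residue≈ : - sum {N} (λ j → V (toℕ (π ⟨$⟩ʳ j))) 𝔽.≈ -1ℤ ^ℤ suc (suc n) * sum {e} (λ k → term c x (toℕ k))
      residue≈ = begin
        - sum {N} (λ j → V (toℕ (π ⟨$⟩ʳ j)))
          ≈⟨ 𝔽.-‿cong (Σ𝔽.sum-permute {N} {e} (λ k → V (toℕ k)) π) ⟨
        - sum {e} (λ k → V (toℕ k))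
          ≈⟨ 𝔽.-‿cong (SemiringSum.*-distribˡ-sum 𝔽.semiring {e} (-1ℤ ^ℤ suc n) (λ k → term c x (toℕ k))) ⟨
        - (-1ℤ ^ℤ suc n * S)
          ≡⟨ negate (-1ℤ ^ℤ suc n) S ⟩
        -1ℤ * -1ℤ ^ℤ suc n * S ∎
        where
        S = sum {e} (λ k → term c x (toℕ k))
        negate : ∀ u v → - (u * v) ≡ -1ℤ * u * v
        negate = solve-∀

    -- The characters T^(it) as powers of ω, and the parameters i/d

    module _ (n t : ℕ) (dt≡e : suc n ℕ.* t ≡ e) where

      t>0 : 0 ℕ.< t
      t>0 = ℕ.n≢0⇒n>0 λ t≡0 → contradiction
        (≡.trans (≡.sym dt≡e) (≡.trans (cong (suc n ℕ.*_) t≡0) (ℕ.*-zeroʳ (suc n)))) λ ()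

      -- `- g` is a unit modulo d, as gm ≡ 1 modulo p - 1 and d divides p - 1. The sign is chosen so
      -- that ω^(git) becomes ω^(p-1-jt) with j ≡ -gi.
      permuted : ∃[ π ] ∀ i → + suc (toℕ (π ⟨$⟩ʳ i)) ≈ - + g * + suc (toℕ {n} i) [mod suc n ]
      permuted = multiplication-permutes (- + g) (- + m)
        (ℤ/.trans (suc n) (ℤ/.reflexive (suc n) (signs (+ g) (+ m)))
          (coarsen (ℕ.divides t (≡.trans (≡.sym dt≡e) (ℕ.*-comm (suc n) t))) gm≈1))
        where
        signs : ∀ g m → - g * - m ≡ g * m
        signs = solve-∀

      σ : Fin n → ℕ
      σ i = suc (toℕ (proj₁ permuted ⟨$⟩ʳ i))

      σt<e : ∀ i → σ i ℕ.* t ℕ.< e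
      σt<e i = subst (σ i ℕ.* t ℕ.<_) dt≡e
        (ℕ.*-monoˡ-< t {{ℕ.>-nonZero t>0}} (ℕ.s<s (Fin.toℕ<n (proj₁ permuted ⟨$⟩ʳ i))))

      -- One less than the exponent p - 1 - σt, which is positive because σt < p - 1.
      a : Fin n → ℕ
      a i = e ℕ.∸ suc (σ i ℕ.* t)

      a+σt≡e : ∀ i → suc (a i) ℕ.+ σ i ℕ.* t ≡ e
      a+σt≡e i = ≡.trans (≡.sym (ℕ.+-suc (a i) (σ i ℕ.* t))) (ℕ.m∸n+n≡m (σt<e i))

      a<e : ∀ i → suc (a i) ℕ.< e
      a<e i = subst (suc (a i) ℕ.<_) (a+σt≡e i)
        (ℕ.m<m+n (suc (a i)) (ℕ.<-≤-trans t>0 (ℕ.m≤m+n t (toℕ (proj₁ permuted ⟨$⟩ʳ i) ℕ.* t))))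

      -- An integer representing (i+1)/d modulo p: dt = p - 1 ≡ -1 gives 1/d ≡ -t.
      c : Fin n → ℤ
      c i = - (+ suc (toℕ i) * + t)

      a≈c : ∀ i → + suc (suc (a i)) 𝔽.≈ c (proj₁ permuted ⟨$⟩ʳ i)
      a≈c i = congruent (divides 1ℤ (≡.trans (cancel (+ suc (suc (a i))) (+ σ i * + t)) (≡.trans
        (cong (λ u → + suc (suc (a i)) + u) (≡.sym (ℤ.pos-* (σ i) t)))
        (≡.trans (cong (λ u → + suc u) (a+σt≡e i)) (≡.sym (ℤ.*-identityˡ (+ (2+ q))))))))
        where
        cancel : ∀ u v → u - - v ≡ u + v
        cancel = solve-∀

      -- With i counted from 1, d divides σ + gi. Multiplied by t this is a divisibility by dt = p -
      -- 1, so the exponents git and p - 1 - σt agree modulo the order of ω.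
      T↑≈ω↑a : ∀ i → T ↑ (suc (toℕ i) ℕ.* t) Ĝ.≈ ω ↑ suc (a i)
      T↑≈ω↑a i = Ĝ.trans {T ↑ (suc (toℕ i) ℕ.* t)} {ω ↑ (suc (toℕ i) ℕ.* t ℕ.* g)} {ω ↑ suc (a i)}
        (T↑≈ω↑ (suc (toℕ i) ℕ.* t)) (shift d∣σ+gi)
        where
        d∣σ+gi : suc n ℕ.∣ σ i ℕ.+ g ℕ.* suc (toℕ i)
        d∣σ+gi = subst (suc n ℕ.∣_) (cong ℤ.∣_∣ (≡.trans (cancel (+ σ i) (+ g) (+ suc (toℕ i)))
          (cong (λ u → + σ i + u) (≡.sym (ℤ.pos-* g (suc (toℕ i)))))))
          (∣⇒∣ᵤ (divisible (proj₂ permuted i)))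
          where
          cancel : ∀ u g i → u - - g * i ≡ u + g * i
          cancel = solve-∀
        shift : suc n ℕ.∣ σ i ℕ.+ g ℕ.* suc (toℕ i) → ω ↑ (suc (toℕ i) ℕ.* t ℕ.* g) Ĝ.≈ ω ↑ suc (a i)
        shift (ℕ.divides l σ+gi≡ld) = ↑-congruent ω (suc (toℕ i) ℕ.* t ℕ.* g) (suc (a i)) 1 l (begin
          I ℕ.* t ℕ.* g ℕ.+ 1 ℕ.* e                              ≡⟨ cong (λ u → I ℕ.* t ℕ.* g ℕ.+ 1 ℕ.* u) (a+σt≡e i) ⟨
          I ℕ.* t ℕ.* g ℕ.+ 1 ℕ.* (suc (a i) ℕ.+ σ i ℕ.* t)      ≡⟨ collect I t g (suc (a i)) (σ i) ⟩
          suc (a i) ℕ.+ t ℕ.* (σ i ℕ.+ g ℕ.* I)                  ≡⟨ cong (λ u → suc (a i) ℕ.+ t ℕ.* u) σ+gi≡ld ⟩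
          suc (a i) ℕ.+ t ℕ.* (l ℕ.* suc n)                      ≡⟨ swap (suc (a i)) t l (suc n) ⟩
          suc (a i) ℕ.+ l ℕ.* (suc n ℕ.* t)                      ≡⟨ cong (λ u → suc (a i) ℕ.+ l ℕ.* u) dt≡e ⟩
          suc (a i) ℕ.+ l ℕ.* e                                  ∎)
          where
          open ≡.≡-Reasoning
          I = suc (toℕ i)
          collect : ∀ I t g a s → I ℕ.* t ℕ.* g ℕ.+ 1 ℕ.* (a ℕ.+ s ℕ.* t) ≡ a ℕ.+ t ℕ.* (s ℕ.+ g ℕ.* I)
          collect = ℕSolver.solve-∀
          swap : ∀ a t l d → a ℕ.+ t ℕ.* (l ℕ.* d) ≡ a ℕ.+ l ℕ.* (d ℕ.* t)
          swap = ℕSolver.solve-∀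

      reducesQ-i/d : ∀ i → ReducesQ (+ suc (toℕ i) ℚᵘ./ suc n) (c i)
      reducesQ-i/d i = reducesQ (small∤ d<p) (congruent (divides (+ suc (toℕ i))
        (≡.trans (collect (+ suc (toℕ i)) (+ t) (+ suc n))
          (cong (λ u → + suc (toℕ i) * (1ℤ + u)) (≡.trans (≡.sym (ℤ.pos-* (suc n) t)) (cong +_ dt≡e))))))
        where
        d<p : suc n ℕ.< (2+ q)
        d<p = ℕ.s≤s (subst (suc n ℕ.≤_) dt≡e (ℕ.m≤m*n (suc n) t {{ℕ.>-nonZero t>0}}))
        collect : ∀ i t d → i - - (i * t) * d ≡ i * (1ℤ + d * t)
        collect = solve-∀

    module _ (n t : ℕ) (dt≡e : suc (suc n) ℕ.* t ≡ e) (x : ℤ) where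

      private
        residues : Fin (suc n) → ℤ
        residues = c (suc n) t dt≡e

        S : ℤ
        S = sum {2+ q} (λ k → term residues x (toℕ k))

      sums≈ : sum {e} (λ k → term (λ i → residues (proj₁ (permuted (suc n) t dt≡e) ⟨$⟩ʳ i)) x (toℕ k)) 𝔽.≈ S
      sums≈ = 𝔽.trans (Σ𝔽.sum-cong-≋ {e} (λ k → term-permute residues x (proj₁ (permuted (suc n) t dt≡e)) (toℕ k)))
        (𝔽.sym (term-sum-truncates residues x t t<e c₀+t≈0))
        where
        -- The first parameter is -t ≡ 1/d, so its rising factorial has a zero factor at position t,
        -- which lies in range because d is at least 2.
        t<e : t ℕ.< e
        t<e = subst (t ℕ.<_) dt≡e (ℕ.m<m+n t (ℕ.<-≤-trans (t>0 (suc n) t dt≡e) (ℕ.m≤m+n t (n ℕ.* t))))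
        c₀+t≈0 : residues Fin.zero + + t 𝔽.≈ 0ℤ
        c₀+t≈0 = 𝔽.reflexive (cancel (+ t))
          where
          cancel : ∀ t → - (1ℤ * t) + t ≡ 0ℤ
          cancel = solve-∀

      greene-residue : ∀ {N} (listing : Listing N) → ¬ + (2+ q) ∣ x →
        Reduces 0 (fromℚᵘ (2+ q) (+ ((2+ q) ℕ.^ n) ℚᵘ./ 1) Q.* greene listing {n} (λ i → T ↑ (suc (toℕ i) ℕ.* t)) (λ _ → ε) x)
          (-1ℤ ^ℤ suc (suc n) * S)
      greene-residue listing p∤x = reduces-cong (𝔽.*-congˡ { -1ℤ ^ℤ suc (suc n)} sums≈)
        (reduces-greene listing (λ i → T ↑ (suc (toℕ i) ℕ.* t)) (a (suc n) t dt≡e)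
          (λ i → residues (proj₁ (permuted (suc n) t dt≡e) ⟨$⟩ʳ i)) x p∤x
          (T↑≈ω↑a (suc n) t dt≡e) (a<e (suc n) t dt≡e) (a≈c (suc n) t dt≡e))

      truncated-residue :
        Reduces 0 (pow Q.rawSemiring (Q.- Q.1#) (suc (suc n)) Q.*
            fromℚᵘ (2+ q) (truncated {n} (λ i → + suc (toℕ i) ℚᵘ./ suc (suc n)) (λ _ → 1ℚᵘ) x (2+ q)))
          (-1ℤ ^ℤ suc (suc n) * S)
      truncated-residue = reduces-* {0} {0} (reduces-^ {Q.- Q.1#} { -1ℤ} (suc (suc n)) (reduces (Z.- Z.1#) Z.refl 𝔽.refl))
        (reduces-fromℚᵘ (reducesQ-truncated (λ i → + suc (toℕ i) ℚᵘ./ suc (suc n)) residues x (reducesQ-i/d (suc n) t dt≡e)))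

      comparison : ∀ {N} (listing : Listing N) → ¬ + (2+ q) ∣ x →
        _≡ₚ_ (2+ q)
          (fromℚᵘ (2+ q) (+ ((2+ q) ℕ.^ n) ℚᵘ./ 1) Q.* greene listing {n} (λ i → T ↑ (suc (toℕ i) ℕ.* t)) (λ _ → ε) x)
          (pow Q.rawSemiring (Q.- Q.1#) (suc (suc n)) Q.*
            fromℚᵘ (2+ q) (truncated {n} (λ i → + suc (toℕ i) ℚᵘ./ suc (suc n)) (λ _ → 1ℚᵘ) x (2+ q)))
      comparison listing p∤x = reduces⇒≡ₚ
        {fromℚᵘ (2+ q) (+ ((2+ q) ℕ.^ n) ℚᵘ./ 1) Q.* greene listing {n} (λ i → T ↑ (suc (toℕ i) ℕ.* t)) (λ _ → ε) x}
        {pow Q.rawSemiring (Q.- Q.1#) (suc (suc n)) Q.*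
          fromℚᵘ (2+ q) (truncated {n} (λ i → + suc (toℕ i) ℚᵘ./ suc (suc n)) (λ _ → 1ℚᵘ) x (2+ q))}
        { -1ℤ ^ℤ suc (suc n) * S} (greene-residue listing p∤x) truncated-residue

theorem3p3 :
    (d : ℕ) .{{_ : NonZero d}} → 2 ≤ d →
    (p : ℕ) (p-prime : Prime p) → + p ≈ + 1 [mod d ] →
    let open Characters p p-prime
        module Q = RawRing (ℚₚ p)
        t = (p ∸ 1) / d
    in
    (T : Character) → IsGenerator T →
    {N : ℕ} (listing : Listing N) →
    (x : ℤ) → ¬ (+ p ∣ x) →
    _≡ₚ_ p
      (fromℚᵘ p (+ (p ^ℕ (d ∸ 2)) /ℚ 1) Q.*
        greene listing {d ∸ 2} (λ i → T ^ (suc (toℕ i) *ℕ t)) (λ _ → ε) x)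
      (pow Q.rawSemiring (Q.- Q.1#) d Q.*
        fromℚᵘ p (truncated {d ∸ 2} (λ i → + suc (toℕ i) /ℚ d) (λ _ → 1ℚᵘ) x p))
theorem3p3 1 (ℕ.s≤s ())
theorem3p3 (suc (suc n)) _ 0 p-prime = contradiction p-prime ¬prime[0]
theorem3p3 (suc (suc n)) _ 1 p-prime = contradiction p-prime ¬prime[1]
theorem3p3 (suc (suc n)) _ (suc (suc q)) p-prime p≈1 T generates listing x p∤x =
  Comparison.comparison q p-prime T generates n (suc q / suc (suc n))
    (ℕ.m*[n/m]≡n (∣⇒∣ᵤ (divisible p≈1))) x listing p∤x
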